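{- For every $\varepsilon\in(0,1)$ there exist positive constants $d_0=d_0(\varepsilon)$ and $D_0=D_0(\varepsilon)$ such that the following holds: if $G$ is an $n$-vertex $\Delta$-critical graph with minimum degree at least $d_0$ and maximum degree $\Delta(G)\ge D_0$, then $\alpha(G)<\left(\frac12+\varepsilon\right)n$.
   Context: All graphs are finite and simple. $\Delta(G)$ is the maximum degree, $\chi'(G)$ the chromatic index, and $\alpha(G)$ the independence number of $G$. A graph $G$ is $\Delta$-critical if $G$ is connected, $\chi'(G)=\Delta(G)+1$, and $\chi'(G-e)=\Delta(G)$ for every edge $e\in E(G)$. -}

module Defs where

open import Data.Nat using (ℕ; zero; suc; _⊔_; _<_; _≤_)
open import Data.Bool using (Bool; true; false; if_then_else_)
open import Data.Fin using (Fin)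
open import Data.Fin.Subset using (Subset; _∈_; ∣_∣)
open import Data.List using (foldr; map; allFin)
open import Data.Nat.ListAction using (sum)
open import Data.Product using (_×_; ∃-syntax)
open import Data.Sum using (_⊎_)
open import Relation.Nullary using (¬_)
open import Relation.Binary.PropositionalEquality using (_≡_; _≢_)

record Graph (n : ℕ) : Set where
  field
    adj   : Fin n → Fin n → Bool
    sym   : ∀ u v → adj u v ≡ adj v u
    irref : ∀ u → adj u u ≡ false
open Graph public

module _ {n : ℕ} (G : Graph n) where

  Adj : Fin n → Fin n → Set
  Adj u v = adj G u v ≡ true

  deg : Fin n → ℕ
  deg v = sum (map (λ u → if adj G v u then 1 else 0) (allFin n))

  maxDeg : ℕ
  maxDeg = foldr _⊔_ 0 (map deg (allFin n))

  data Reach : Fin n → Fin n → Set where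
    here : ∀ {u} → Reach u u
    step : ∀ {u v w} → Adj u v → Reach v w → Reach u w

  Connected : Set
  Connected = ∀ u v → Reach u v

  AdjMinus : Fin n → Fin n → Fin n → Fin n → Set
  AdjMinus a b u v = Adj u v × ¬ ((u ≡ a × v ≡ b) ⊎ (u ≡ b × v ≡ a))

  Independent : Subset n → Set
  Independent S = ∀ u v → u ∈ S → v ∈ S → adj G u v ≡ false

  IsIndependenceNumber : ℕ → Set
  IsIndependenceNumber a =
    (∃[ S ] (Independent S × ∣ S ∣ ≡ a)) × (∀ S → Independent S → ∣ S ∣ ≤ a)

-- A proper edge colouring with k colours of the graph on Fin n whose
-- (symmetric) edge relation is E: each edge gets one colour (independent
-- of orientation), and edges sharing an endpoint get distinct colours.
record EdgeColouring {n : ℕ} (E : Fin n → Fin n → Set) (k : ℕ) : Set where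
  field
    col    : ∀ u v → E u v → Fin k
    sym    : ∀ u v (e : E u v) (e' : E v u) → col u v e ≡ col v u e'
    proper : ∀ u v w (e : E u v) (e' : E u w) → v ≢ w → col u v e ≢ col u w e'

HasChromaticIndex : ∀ {n} → (Fin n → Fin n → Set) → ℕ → Set
HasChromaticIndex E k = EdgeColouring E k × (∀ j → j < k → ¬ EdgeColouring E j)

Critical : ∀ {n} → Graph n → Set
Critical G =
  Connected G ×
  HasChromaticIndex (Adj G) (suc (maxDeg G)) ×
  (∀ a b → Adj G a b → HasChromaticIndex (AdjMinus G a b) (maxDeg G))

{-# OPTIONS --safe #-}
module Submission where

-- Let Δ be the maximum degree and call a vertex low if its degree is at most
-- (1 - 1/q) Δ. In an independent set S the vertices that are not low number at
-- most q / (q - 1) times the complement, by counting edges. For a low x it is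
-- enough that ℓ, the number of low neighbours, is small compared with deg x on
-- a large part of N(x): spreading x over that part puts little weight on each
-- vertex of the complement.
--
-- Suppose y₀ ∈ N(x) has ℓ(y₀) ≥ deg x / s while ℓ is large on most of N(x), and
-- colour G - xy₀. Low vertices miss at least Δ/q colours, so Vizing fans give y₀
-- only q low neighbours through colours missing at x; hence many colours c lead
-- from y₀ to a low vertex z and from x to some y with ℓ(y) large. A Kempe change
-- makes a colour α missing at y₀ missing at p of these z; recolouring y₀z to α and
-- moving c from xy to xy₀ then makes xy the uncoloured edge instead. The same fan
-- bound holds at each of these p vertices y, so by averaging many colours d lead
-- to low vertices from more than 2q of them. Two Kempe changes turn such a d into
-- a colour that is missing at x and still leads from one of the y to a low
-- vertex. Doing this for pq + 1 colours overfills the fan at some y.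

open import Defs

module CriticalGraphs where
  open import Data.Bool using (true; false; if_then_else_)
  import Data.Bool.Properties as 𝔹
  open import Data.Empty using (⊥; ⊥-elim)
  open import Data.Fin using (Fin; zero; suc; toℕ; punchIn)
  open import Data.Fin.Properties using (_≟_; any?; pigeonhole; punchIn-injective; punchInᵢ≢i; suc-injective)
  open import Data.Fin.Subset using (Subset; ∣_∣) renaming (_∈_ to _∈ˢ_)
  open import Data.Fin.Subset.Properties using () renaming (_∈?_ to _∈ˢ?_)
  import Data.Integer as ℤ
  import Data.Integer.Properties as ℤₚ
  open import Data.List using (List; []; _∷_; _++_; length; tabulate; foldr)
  open import Data.List.Properties using (map-tabulate; length-tabulate; length-++)
  open import Data.List.Membership.Propositional using (_∈_; _∉_)
  open import Data.List.Membership.Propositional.Properties using (∈-++⁻; ∈-++⁺ˡ; ∈-++⁺ʳ; ∈-tabulate⁺; ∈-tabulate⁻; ∈-map⁺; ∈-allFin)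
  open import Data.List.Relation.Unary.Any using (here; there)
  open import Data.Nat using (ℕ; zero; suc; _+_; _*_; _∸_; _⊔_; _!; ⌊_/2⌋; _≤_; _<_; _≤?_; z≤n; s≤s; s≤s⁻¹)
  import Data.Nat as ℕ
  open import Data.Nat.Divisibility using (_∣_; divides; ∣-trans; m∣m*n; m≤n⇒m!∣n!)
  open import Data.Nat.Induction using (<-rec)
  open import Data.Nat.ListAction using () renaming (sum to sumᴸ)
  open import Data.Nat.Properties using (≤-refl; ≤-trans; ≤-reflexive; +-mono-≤; _!≢0; module ≤-Reasoning)
  import Data.Nat.Properties as ℕₚ
  open import Data.Nat.Tactic.RingSolver using (solve-∀)
  open import Data.Product using (Σ; _×_; _,_; proj₁; proj₂; ∃-syntax)
  open import Data.Rational using (ℚ; 0ℚ; ½; mkℚ; toℚᵘ)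
  import Data.Rational as ℚ
  import Data.Rational.Properties as ℚₚ
  open import Data.Rational.Unnormalised using (mkℚᵘ)
  import Data.Rational.Unnormalised as ℚᵘ
  import Data.Rational.Unnormalised.Properties as ℚᵘₚ
  open import Data.Sum using (_⊎_; inj₁; inj₂; [_,_]′)
  open import Data.Vec using ([]; _∷_)
  open import Function using (_∘_; id)
  open import Relation.Binary.Definitions using (tri<; tri≈; tri>)
  open import Relation.Binary.PropositionalEquality using (_≡_; _≢_; refl; trans; cong; cong₂; subst; subst₂; module ≡-Reasoning) renaming (sym to ≡-sym)
  open import Relation.Nullary using (Dec; yes; no; ¬_; ¬?; _×-dec_; _⊎-dec_; contradiction)
  open import Algebra.Properties.Semiring.Sum ℕₚ.+-*-semiring using (sum; ∑-comm; ∑-distrib-+; sum-cong-≗; *-distribˡ-sum; *-distribʳ-sum)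

  -- Counting over Fin

  private variable
    m n r : ℕ

  Inj : ∀ {A B : Set} → (A → B) → Set
  Inj f = ∀ {i j} → f i ≡ f j → i ≡ j

  sum-mono : {f g : Fin n → ℕ} → (∀ i → f i ≤ g i) → sum f ≤ sum g
  sum-mono {zero}  h = z≤n
  sum-mono {suc n} h = +-mono-≤ (h zero) (sum-mono (h ∘ suc))

  sum-const : ∀ n c → sum {n} (λ _ → c) ≡ n * c
  sum-const zero    c = refl
  sum-const (suc n) c = cong (c +_) (sum-const n c)

  sum-pigeonhole : (f : Fin n → ℕ) → n * m < sum f → ∃[ i ] m < f i
  sum-pigeonhole {n} {m} f h with any? (λ i → m ℕ.<? f i)
  ... | yes p = p
  ... | no ¬p = contradiction h (ℕₚ.≤⇒≯ (≤-trans (sum-mono (λ i → ℕₚ.≮⇒≥ (λ q → ¬p (i , q))))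
      (≤-reflexive (sum-const n m))))

  ind : {P : Set} → Dec P → ℕ
  ind (yes _) = 1
  ind (no _)  = 0

  ind-mono : {P Q : Set} (p : Dec P) (q : Dec Q) → (P → Q) → ind p ≤ ind q
  ind-mono (yes p) (yes q) f = ≤-refl
  ind-mono (yes p) (no ¬q) f = contradiction (f p) ¬q
  ind-mono (no ¬p) q       f = z≤n

  ind≤1 : {P : Set} (p : Dec P) → ind p ≤ 1
  ind≤1 (yes _) = ≤-refl
  ind≤1 (no _)  = z≤n

  ind-yes : {P : Set} (p : Dec P) → P → ind p ≡ 1
  ind-yes (yes _) _ = refl
  ind-yes (no ¬p) p = contradiction p ¬p

  ind-no : {P : Set} (p : Dec P) → ¬ P → ind p ≡ 0
  ind-no (yes p) ¬p = contradiction p ¬p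
  ind-no (no _) _ = refl

  # : {P : Fin n → Set} → (∀ i → Dec (P i)) → ℕ
  # P? = sum (λ i → ind (P? i))

  #-mono : {P Q : Fin n → Set} (P? : ∀ i → Dec (P i)) (Q? : ∀ i → Dec (Q i)) → (∀ i → P i → Q i) → # P? ≤ # Q?
  #-mono P? Q? f = sum-mono (λ i → ind-mono (P? i) (Q? i) (f i))

  #≤n : {P : Fin n → Set} (P? : ∀ i → Dec (P i)) → # P? ≤ n
  #≤n {n} P? = ≤-trans (sum-mono (λ i → ind≤1 (P? i))) (≤-reflexive (trans (sum-const n 1) (ℕₚ.*-identityʳ n)))

  #-all : {P : Fin n → Set} (P? : ∀ i → Dec (P i)) → (∀ i → P i) → # P? ≡ n
  #-all {n} P? f = trans (sum-cong-≗ (λ i → ind-yes (P? i) (f i))) (trans (sum-const n 1) (ℕₚ.*-identityʳ n))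

  #-none : {P : Fin n → Set} (P? : ∀ i → Dec (P i)) → (∀ i → ¬ P i) → # P? ≡ 0
  #-none {n} P? f = trans (sum-cong-≗ (λ i → ind-no (P? i) (f i))) (trans (sum-const n 0) (ℕₚ.*-zeroʳ n))

  #-cover : {P Q R : Fin n → Set} (P? : ∀ i → Dec (P i)) (Q? : ∀ i → Dec (Q i)) (R? : ∀ i → Dec (R i)) →
    (∀ i → P i → Q i ⊎ R i) → # P? ≤ # Q? + # R?
  #-cover P? Q? R? f = ≤-trans (sum-mono (λ i → pt (P? i) (Q? i) (R? i) (f i)))
      (≤-reflexive (∑-distrib-+ (λ i → ind (Q? i)) (λ i → ind (R? i))))
    where
    pt : {P Q R : Set} (p : Dec P) (q : Dec Q) (r : Dec R) → (P → Q ⊎ R) → ind p ≤ ind q + ind r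
    pt (no _) q r f = z≤n
    pt (yes p) (yes q) r f = s≤s z≤n
    pt (yes p) (no ¬q) (yes r) f = s≤s z≤n
    pt (yes p) (no ¬q) (no ¬r) f = ⊥-elim ([ ¬q , ¬r ]′ (f p))

  #-compl : {P : Fin n → Set} (P? : ∀ i → Dec (P i)) → # P? + # (¬? ∘ P?) ≡ n
  #-compl {n} P? = trans (≡-sym (∑-distrib-+ (λ i → ind (P? i)) (λ i → ind (¬? (P? i)))))
      (trans (sum-cong-≗ (λ i → pt (P? i))) (trans (sum-const n 1) (ℕₚ.*-identityʳ n)))
    where
    pt : {P : Set} (p : Dec P) → ind p + ind (¬? p) ≡ 1
    pt (yes _) = refl
    pt (no _) = refl

  #-eq : (j : Fin n) → # (_≟ j) ≤ 1
  #-eq {suc n} zero = s≤s (≤-reflexive (#-none {n} (λ i → suc i ≟ zero) (λ i ())))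
  #-eq {suc n} (suc j) = ≤-trans (#-mono (λ i → suc i ≟ suc j) (_≟ j) (λ i → suc-injective)) (#-eq j)

  #-∖ : {P : Fin n → Set} (P? : ∀ i → Dec (P i)) (j : Fin n) → # P? ≤ suc (# (λ i → P? i ×-dec ¬? (i ≟ j)))
  #-∖ P? j = ≤-trans (#-cover P? (_≟ j) (λ i → P? i ×-dec ¬? (i ≟ j)) cs) (+-mono-≤ (#-eq j) ≤-refl)
    where
    cs : ∀ i → _ → _
    cs i p with i ≟ j
    ... | yes e = inj₁ e
    ... | no ¬e = inj₂ (p , ¬e)

  #-∖< : {P : Fin n → Set} (P? : ∀ i → Dec (P i)) (j : Fin n) → P j → # (λ i → P? i ×-dec ¬? (i ≟ j)) < # P?
  #-∖< {suc n} P? zero p rewrite ind-yes (P? zero) p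
      | ind-no (P? zero ×-dec ¬? (zero {n} ≟ zero)) (λ q → proj₂ q refl) =
    s≤s (#-mono (λ i → P? (suc i) ×-dec ¬? (suc i ≟ zero)) (P? ∘ suc) (λ _ → proj₁))
  #-∖< {suc n} P? (suc j) p = ≤-trans (≤-reflexive (≡-sym (ℕₚ.+-suc _ _)))
    (+-mono-≤ (ind-mono (P? zero ×-dec ¬? (zero ≟ suc j)) (P? zero) proj₁)
     (≤-trans (s≤s (#-mono (λ i → P? (suc i) ×-dec ¬? (suc i ≟ suc j)) (λ i → P? (suc i) ×-dec ¬? (i ≟ j))
         (λ i q → proj₁ q , λ e → proj₂ q (cong suc e)))) (#-∖< (P? ∘ suc) j p)))

  #-inj : {P : Fin m → Set} {Q : Fin n → Set} (P? : ∀ i → Dec (P i)) (Q? : ∀ i → Dec (Q i))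
      (g : ∀ i → P i → Fin n) →
    (∀ i p → Q (g i p)) → (∀ {i j} p p′ → g i p ≡ g j p′ → i ≡ j) → # P? ≤ # Q?
  #-inj {zero} P? Q? g h inj = z≤n
  #-inj {suc m} {P = P} P? Q? g h inj with P? zero
  ... | no _ = #-inj (P? ∘ suc) Q? (g ∘ suc) (h ∘ suc) (λ p p′ e → suc-injective (inj p p′ e))
  ... | yes p = ≤-trans (s≤s (#-inj (P? ∘ suc) (λ i → Q? i ×-dec ¬? (i ≟ g zero p)) (g ∘ suc)
          (λ i p′ → h (suc i) p′ , λ e → case0 (inj p′ p e)) (λ p p′ e → suc-injective (inj p p′ e))))
          (#-∖< Q? (g zero p) (h zero p))
    where
    case0 : ∀ {i : Fin m} → suc i ≡ zero → ⊥
    case0 ()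

  abstract
    -- Counting yields lower bounds on `#`; this turns such a bound into distinct witnesses indexed
    -- by `Fin r`, the form in which colours and vertices are handed on.
    #-extract : {P : Fin n → Set} (P? : ∀ i → Dec (P i)) → r ≤ # P? → Σ (Fin r → Fin n) λ h → Inj h ×
        (∀ i → P (h i))
    #-extract {r = zero} P? le = (λ ()) , (λ { {()} }) , (λ ())
    #-extract {zero} {suc r} P? ()
    #-extract {suc n} {suc r} {P} P? le with P? zero
    ... | no _ = let h , inj , ok = #-extract (P? ∘ suc) le in suc ∘ h , (λ e → inj (suc-injective e)) , ok
    ... | yes p with #-extract (P? ∘ suc) (s≤s⁻¹ le)
    ...   | h , inj , ok = h′ , inj′ , ok′
      where
      h′ : Fin (suc r) → Fin (suc n)
      h′ zero = zero
      h′ (suc i) = suc (h i)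
      inj′ : Inj h′
      inj′ {zero} {zero} e = refl
      inj′ {suc i} {suc j} e = cong suc (inj (suc-injective e))
      ok′ : ∀ i → P (h′ i)
      ok′ zero = p
      ok′ (suc i) = ok i

  #-swap : {R : Fin m → Fin n → Set} (R? : ∀ i j → Dec (R i j)) →
      sum (λ i → # (R? i)) ≡ sum (λ j → # (λ i → R? i j))
  #-swap R? = ∑-comm (λ i j → ind (R? i j))

  abstract
    -- A Kempe chain from a given start has at most one other end `e`, and at most one of several
    -- distinct vertices is that end, so dropping one index suffices. If none of them is `e`, index
    -- zero is dropped.
    avoid : (w : Fin (suc m) → Fin n) → Inj w → ∀ e → Σ (Fin m → Fin (suc m)) λ h → Inj h × (∀ i → w (h i) ≢ e)
    avoid w inj e with any? (λ i → w i ≟ e)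
    ... | yes (i , p) = punchIn i , (λ {j} {k} → punchIn-injective i j k) , λ j q →
        punchInᵢ≢i i j (inj (trans q (≡-sym p)))
    ... | no ¬p = punchIn zero , (λ {j} {k} → punchIn-injective zero j k) , λ j q → ¬p (_ , q)

  module _ {n : ℕ} where
    open import Data.List.Membership.DecPropositional (_≟_ {n}) public using (_∈?_)

    #-∈ : (F : List (Fin n)) → # (_∈? F) ≤ length F
    #-∈ [] = ≤-reflexive (#-none (_∈? []) (λ i ()))
    #-∈ (x ∷ F) = ≤-trans (#-cover (_∈? (x ∷ F)) (_≟ x) (_∈? F)
        (λ { i (here e) → inj₁ e ; i (there p) → inj₂ p }))
      (+-mono-≤ (#-eq x) (#-∈ F))

  -- Two involutions

  least : {P : ℕ → Set} → (∀ i → Dec (P i)) → ∀ m → P m → ∃[ k ] P k × (∀ i → i < k → ¬ P i)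
  least {P} P? = <-rec _ go
    where
    go : ∀ m → (∀ {j} → j < m → P j → ∃[ k ] P k × (∀ i → i < k → ¬ P i)) → P m → ∃[ k ] P k ×
        (∀ i → i < k → ¬ P i)
    go m rec p with ℕₚ.anyUpTo? P? m
    ... | yes (j , j<m , q) = rec j<m q
    ... | no ¬q = m , p , λ i i<m q → ¬q (i , i<m , q)

  -- A vertex fixed by f or g inside the orbit of u is f g … f u with the walk
  -- folded back onto itself, so it sits half-way round the cycle of f ∘ g.
  module Orbit {n : ℕ} (f g : Fin n → Fin n) (ff : ∀ v → f (f v) ≡ v) (gg : ∀ v → g (g v) ≡ v) (u : Fin n)
      (fu : f u ≡ u) where

    o : ℕ → Fin n
    o zero    = u
    o (suc i) = f (g (o i))

    fg-inj : ∀ {v w} → f (g v) ≡ f (g w) → v ≡ w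
    fg-inj {v} {w} e = trans (≡-sym (gg v)) (trans (cong g
        (trans (≡-sym (ff (g v))) (trans (cong f e) (ff (g w))))) (gg w))

    -- `f ∘ g` is injective, so any coincidence in the walk can be cancelled back to `u`: the walk
    -- is periodic with no tail.
    o-cancel : ∀ i d → o (i + d) ≡ o i → o d ≡ u
    o-cancel zero    d e = e
    o-cancel (suc i) d e = o-cancel i d (fg-inj e)

    o-cancel< : ∀ {i j} → i < j → o i ≡ o j → o (j ∸ i) ≡ u
    o-cancel< {i} {j} i<j e = o-cancel i (j ∸ i) (trans (cong o (ℕₚ.m+[n∸m]≡n (ℕₚ.<⇒≤ i<j))) (≡-sym e))

    period : ∃[ N ] (0 < N × o N ≡ u) × (∀ i → i < N → ¬ (0 < i × o i ≡ u))
    period with pigeonhole {m = n} ℕₚ.≤-refl (o ∘ toℕ)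
    ... | i , j , i<j , e = least (λ k → (0 ℕ.<? k) ×-dec (o k ≟ u)) (toℕ j ∸ toℕ i)
        (ℕₚ.m<n⇒0<n∸m i<j , o-cancel< i<j e)

    N : ℕ
    N = proj₁ period
    oN : o N ≡ u
    oN = proj₂ (proj₁ (proj₂ period))
    N>0 : 0 < N
    N>0 = proj₁ (proj₁ (proj₂ period))

    o-inj : ∀ {i j} → i < N → j < N → o i ≡ o j → i ≡ j
    o-inj {i} {j} i<N j<N e with ℕₚ.<-cmp i j
    ... | tri≈ _ p _ = p
    ... | tri< i<j _ _ = ⊥-elim (proj₂ (proj₂ period) (j ∸ i) (ℕₚ.≤-<-trans (ℕₚ.m∸n≤m j i) j<N)
        (ℕₚ.m<n⇒0<n∸m i<j , o-cancel< i<j e))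
    ... | tri> _ _ j<i = ⊥-elim (proj₂ (proj₂ period) (i ∸ j) (ℕₚ.≤-<-trans (ℕₚ.m∸n≤m i j) i<N)
        (ℕₚ.m<n⇒0<n∸m j<i , o-cancel< j<i (≡-sym e)))

    -- `f` conjugates `f ∘ g` to its inverse and fixes `u`, so it reflects the cycle, taking index i
    -- to N - i. The equation `i + d ≡ N` spares the subtraction.
    f-o : ∀ i d → i + d ≡ N → f (o i) ≡ o d
    f-o zero    d e = trans fu (trans (≡-sym oN) (cong o (≡-sym e)))
    f-o (suc i) d e = fg-inj (begin
      f (g (f (o (suc i))))  ≡⟨ cong (f ∘ g) (ff (g (o i))) ⟩
      f (g (g (o i)))        ≡⟨ cong f (gg (o i)) ⟩
      f (o i)                ≡⟨ f-o i (suc d) (trans (ℕₚ.+-suc i d) e) ⟩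
      o (suc d)              ∎)
      where open ≡-Reasoning

    g-o : ∀ i d → suc i + d ≡ N → g (o i) ≡ o d
    g-o i d e = trans (≡-sym (ff (g (o i)))) (f-o (suc i) d e)

    C : Fin n → Set
    C v = ∃[ i ] (i < N × o i ≡ v)

    C? : ∀ v → Dec (C v)
    C? v = ℕₚ.anyUpTo? (λ i → o i ≟ v) N

    C-u : C u
    C-u = 0 , N>0 , refl

    C-o : ∀ {d} → d ≤ N → C (o d)
    C-o {d} d≤N with ℕₚ.m≤n⇒m<n∨m≡n d≤N
    ... | inj₁ d<N = d , d<N , refl
    ... | inj₂ refl = 0 , N>0 , ≡-sym oN

    C-f : ∀ {v} → C v → C (f v)
    C-f (i , i<N , refl) = subst C (≡-sym (f-o i (N ∸ i) (ℕₚ.m+[n∸m]≡n (ℕₚ.<⇒≤ i<N)))) (C-o (ℕₚ.m∸n≤m N i))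

    C-g : ∀ {v} → C v → C (g v)
    C-g (i , i<N , refl) = subst C (≡-sym (g-o i (N ∸ suc i) (ℕₚ.m+[n∸m]≡n i<N))) (C-o (ℕₚ.m∸n≤m N (suc i)))

    end : Fin n
    end = o ⌊ N /2⌋

    C-end : ∀ {v} → C v → f v ≡ v ⊎ g v ≡ v → v ≡ u ⊎ v ≡ end
    -- If `f` fixes `o i` then N = 2i, and if `g` does then N = 2i + 1; both make i the integer half
    -- of N. Index 0 is treated apart because `f` reflects it to N, out of the range of `o-inj`.
    C-end (zero , _ , refl) _ = inj₁ refl
    C-end (i@(suc i′) , i<N , refl) (inj₁ e) = inj₂
        (cong o (trans (ℕₚ.n≡⌊n+n/2⌋ i) (cong ⌊_/2⌋ (trans (cong (i +_) (≡-sym same)) sum-N))))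
      where
      sum-N : i + (N ∸ i) ≡ N
      sum-N = ℕₚ.m+[n∸m]≡n (ℕₚ.<⇒≤ i<N)
      same : N ∸ i ≡ i
      same = o-inj (ℕₚ.∸-monoʳ-< {N} {i} {0} (s≤s z≤n) (ℕₚ.<⇒≤ i<N)) i<N (trans (≡-sym (f-o i (N ∸ i) sum-N)) e)
    C-end (i@(suc i′) , i<N , refl) (inj₂ e) = inj₂
        (cong o (trans (ℕₚ.n≡⌈n+n/2⌉ i) (cong ⌊_/2⌋ (trans (cong (suc i +_) (≡-sym same)) sum-N))))
      where
      sum-N : suc i + (N ∸ suc i) ≡ N
      sum-N = ℕₚ.m+[n∸m]≡n i<N
      same : N ∸ suc i ≡ i
      same = o-inj (ℕₚ.∸-monoʳ-< {N} {suc i} {0} (s≤s z≤n) i<N) i<N (trans (≡-sym (g-o i (N ∸ suc i) sum-N)) e)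

  -- Partial edge colourings

  module _ {k : ℕ} (a b : Fin k) where

    swap : Fin k → Fin k
    swap d with d ≟ a | d ≟ b
    ... | yes _ | _     = b
    ... | no _  | yes _ = a
    ... | no _  | no _  = d

    swap-a : swap a ≡ b
    swap-a with a ≟ a | a ≟ b
    ... | yes _ | _ = refl
    ... | no ¬p | _ = contradiction refl ¬p

    swap-b : swap b ≡ a
    swap-b with b ≟ a | b ≟ b
    ... | yes p | _ = p
    ... | no _  | yes _ = refl
    ... | no _  | no ¬p = contradiction refl ¬p

    swap-other : ∀ {d} → d ≢ a → d ≢ b → swap d ≡ d
    swap-other {d} d≢a d≢b with d ≟ a | d ≟ b
    ... | yes p | _     = contradiction p d≢a
    ... | no _  | yes p = contradiction p d≢b
    ... | no _  | no _  = refl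

    swap-cases : ∀ d → (d ≡ a ⊎ d ≡ b) ⊎ (d ≢ a × d ≢ b)
    swap-cases d with d ≟ a | d ≟ b
    ... | yes p | _     = inj₁ (inj₁ p)
    ... | no _  | yes p = inj₁ (inj₂ p)
    ... | no p  | no q  = inj₂ (p , q)

    swap-invol : ∀ d → swap (swap d) ≡ d
    swap-invol d with swap-cases d
    ... | inj₁ (inj₁ refl) = trans (cong swap swap-a) swap-b
    ... | inj₁ (inj₂ refl) = trans (cong swap swap-b) swap-a
    ... | inj₂ (p , q) = trans (cong swap (swap-other p q)) (swap-other p q)

  module _ {n : ℕ} (G : Graph n) where
    Adj? : ∀ u v → Dec (Adj G u v)
    Adj? u v = adj G u v 𝔹.≟ true

    Adj-sym : ∀ {u v} → Adj G u v → Adj G v u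
    Adj-sym {u} {v} p = trans (Graph.sym G v u) p

    Adj-irrefl : ∀ {u} → ¬ Adj G u u
    Adj-irrefl {u} p with trans (≡-sym p) (irref G u)
    ... | ()

  module Colouring {n : ℕ} (G : Graph n) (k : ℕ) where

    -- The colour classes of a partial proper edge colouring, each encoded as the
    -- involution matching its edges; nb c v ≡ v says that c is missing at v.
    record PartialColouring : Set where
      field
        nb    : Fin k → Fin n → Fin n
        invol : ∀ c v → nb c (nb c v) ≡ v
        edge  : ∀ {c v} → nb c v ≢ v → Adj G v (nb c v)
        uniq  : ∀ {c d v} → nb c v ≢ v → nb c v ≡ nb d v → c ≡ d
    open PartialColouring public

    Miss : PartialColouring → Fin k → Fin n → Set
    Miss φ c v = nb φ c v ≡ v

    Col : PartialColouring → Fin n → Fin n → Set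
    Col φ u v = ∃[ c ] nb φ c u ≡ v

    SameEdge : Fin n → Fin n → Fin n → Fin n → Set
    SameEdge x y u v = (u ≡ x × v ≡ y) ⊎ (u ≡ y × v ≡ x)

    AllBut : Fin n → Fin n → PartialColouring → Set
    AllBut x y φ = ∀ u v → Adj G u v → Col φ u v ⊎ SameEdge x y u v

    nb-flip : ∀ φ {c u v} → nb φ c u ≡ v → nb φ c v ≡ u
    nb-flip φ {c} {u} refl = invol φ c u

    nb-inj : ∀ φ c {u v} → nb φ c u ≡ nb φ c v → u ≡ v
    nb-inj φ c {u} {v} e = trans (≡-sym (invol φ c u)) (nb-flip φ (≡-sym e))

    -- The exchange takes place outside `C`. As `C` is closed under both involutions, no edge
    -- coloured `a` or `b` crosses its border; vertices whose colours must survive are put into `C`.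
    module Swap (φ : PartialColouring) (a b : Fin k) (C : Fin n → Set) (C? : ∀ v → Dec (C v))
      (Ca : ∀ {v} → C v → C (nb φ a v)) (Cb : ∀ {v} → C v → C (nb φ b v)) where

      sel : ∀ {v} → Dec (C v) → Fin k → Fin k
      sel (yes _) d = d
      sel (no _)  d = swap a b d

      sel-inj : ∀ {v} (p : Dec (C v)) {c d} → sel p c ≡ sel p d → c ≡ d
      sel-inj (yes _) e = e
      sel-inj (no _) {c} {d} e = trans (≡-sym (swap-invol a b c)) (trans (cong (swap a b) e) (swap-invol a b d))

      new : Fin k → Fin n → Fin n
      new d v = nb φ (sel (C? v) d) v

      new-in : ∀ {v} d → C v → new d v ≡ nb φ d v
      new-in {v} d p with C? v
      ... | yes _ = refl
      ... | no ¬p = contradiction p ¬p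

      new-out : ∀ {v} d → ¬ C v → new d v ≡ nb φ (swap a b d) v
      new-out {v} d ¬p with C? v
      ... | yes p = contradiction p ¬p
      ... | no _ = refl

      new-other : ∀ {d} v → d ≢ a → d ≢ b → new d v ≡ nb φ d v
      new-other {d} v p q with C? v
      ... | yes _ = refl
      ... | no _ = cong (λ e → nb φ e v) (swap-other a b p q)

      closed : ∀ d {v} → d ≡ a ⊎ d ≡ b → C v → C (nb φ d v)
      closed d (inj₁ refl) p = Ca p
      closed d (inj₂ refl) p = Cb p

      new-invol : ∀ d v → new d (new d v) ≡ v
      new-invol d v with swap-cases a b d
      ... | inj₂ (p , q) = trans (new-other (new d v) p q)
          (trans (cong (nb φ d) (new-other v p q)) (invol φ d v))
      ... | inj₁ d∈ = cs (C? v)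
        where
        d∈′ : swap a b d ≡ a ⊎ swap a b d ≡ b
        d∈′ = [ (λ { refl → inj₂ (swap-a a b) }) , (λ { refl → inj₁ (swap-b a b) }) ]′ d∈
        cs : Dec (C v) → new d (new d v) ≡ v
        cs (yes p) = trans (cong (new d) (new-in d p)) (trans (new-in d (closed d d∈ p)) (invol φ d v))
        cs (no ¬p) = trans (cong (new d) (new-out d ¬p))
            (trans (new-out d (λ q → ¬p (subst C (invol φ _ v) (closed _ d∈′ q)))) (invol φ _ v))

      φ′ : PartialColouring
      φ′ = record
        { nb = new
        ; invol = new-invol
        ; edge = edge φ
        ; uniq = λ {c} {d} {v} p e → sel-inj (C? v) (uniq φ p e)
        }

      col : ∀ {u v} → Col φ u v → Col φ′ u v
      col {u} (c , e) = go (C? u)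
        where
        go : Dec (C u) → Col φ′ u _
        go (yes p) = c , trans (new-in c p) e
        go (no ¬p) = swap a b c , trans (new-out (swap a b c) ¬p)
            (trans (cong (λ d → nb φ d u) (swap-invol a b c)) e)

      good : ∀ {x y} → AllBut x y φ → AllBut x y φ′
      good g u v p = [ inj₁ ∘ col , inj₂ ]′ (g u v p)

    -- Swaps a and b everywhere except on the (a, b)-chain that starts at u and stops at end.
    record Kempe (φ : PartialColouring) (u : Fin n) (a b : Fin k) : Set where
      field
        φ′    : PartialColouring
        end   : Fin n
        other : ∀ {d} v → d ≢ a → d ≢ b → nb φ′ d v ≡ nb φ d v
        start : ∀ d → nb φ′ d u ≡ nb φ d u
        -- A vertex missing `a` or `b` is an end of its chain, so unless it is `u` or `end` it lies
        -- on a chain that gets swapped. With `w` equal to `v` this turns `b` missing at `v` into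
        -- `a` missing at `v`.
        out   : ∀ {v} → v ≢ u → v ≢ end → Miss φ a v ⊎ Miss φ b v → ∀ {w} → nb φ b w ≡ v → nb φ′ a w ≡ v
        good  : ∀ {x y} → AllBut x y φ → AllBut x y φ′

    abstract
      kempe : ∀ φ u a b → Miss φ a u → Kempe φ u a b
      kempe φ u a b au = record
        { φ′ = S.φ′
        ; end = O.end
        ; other = λ v → S.new-other v
        ; start = λ d → S.new-in d O.C-u
        ; out = λ {v} v≢u v≢e m {w} e → trans (S.new-out a
            (λ Cw → [ v≢u , v≢e ]′ (O.C-end (subst O.C e (O.C-g Cw)) m)))
                  (trans (cong (λ d → nb φ d w) (swap-a a b)) e)
        ; good = S.good
        }
        where
        module O = Orbit (nb φ a) (nb φ b) (invol φ a) (invol φ b) u au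
        module S = Swap φ a b O.C O.C? O.C-f O.C-g

    -- Recolouring yz from a to μ is the swap of a and μ confined to {y, z}.
    module _ (φ : PartialColouring) {a μ : Fin k} {y z : Fin n} (az : nb φ a y ≡ z) (y≢z : y ≢ z)
        (μy : Miss φ μ y) (μz : Miss φ μ z) where

      private
        C : Fin n → Set
        C v = v ≢ y × v ≢ z
        C? : ∀ v → Dec (C v)
        C? v = ¬? (v ≟ y) ×-dec ¬? (v ≟ z)
        Ca : ∀ {v} → C v → C (nb φ a v)
        Ca (p , q) = (λ e → q (trans (≡-sym (nb-flip φ e)) az)) ,
            (λ e → p (trans (≡-sym (nb-flip φ e)) (nb-flip φ az)))
        Cμ : ∀ {v} → C v → C (nb φ μ v)
        Cμ (p , q) = (λ e → p (trans (≡-sym (nb-flip φ e)) μy)) , (λ e → q (trans (≡-sym (nb-flip φ e)) μz))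
        module S = Swap φ a μ C C? Ca Cμ

      recolour : PartialColouring
      recolour = S.φ′

      recolour-good : ∀ {x y} → AllBut x y φ → AllBut x y recolour
      recolour-good = S.good

      recolour-other : ∀ {d} v → d ≢ a → d ≢ μ → nb recolour d v ≡ nb φ d v
      recolour-other v = S.new-other v

      recolour-away : ∀ {v} d → v ≢ y → v ≢ z → nb recolour d v ≡ nb φ d v
      recolour-away d p q = S.new-in d (p , q)

      recolour-y : Miss recolour a y
      recolour-y = trans (S.new-out a (λ p → proj₁ p refl)) (trans (cong (λ d → nb φ d y) (swap-a a μ)) μy)

    -- Gives xy the colour c, taking c away from the edge at x that has it. If c is missing at x,
    -- then nb φ c x ≡ x and nothing is left uncoloured.
    module Shift (φ : PartialColouring) {x y : Fin n} (xy : Adj G x y) (un : ∀ d → nb φ d x ≢ y) (c : Fin k)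
        (cy : Miss φ c y) where

      x≢y : x ≢ y
      x≢y refl = Adj-irrefl G xy

      h : Fin n → Fin n
      h w with w ≟ x | w ≟ y | w ≟ nb φ c x
      ... | yes _ | _     | _     = y
      ... | no _  | yes _ | _     = x
      ... | no _  | no _  | yes _ = w
      ... | no _  | no _  | no _  = nb φ c w

      h-x : h x ≡ y
      h-x with x ≟ x
      ... | yes _ = refl
      ... | no p = contradiction refl p

      h-y : h y ≡ x
      h-y with y ≟ x | y ≟ y
      ... | yes p | _ = contradiction (≡-sym p) x≢y
      ... | no _ | yes _ = refl
      ... | no _ | no p = contradiction refl p

      h-old : ∀ {w} → w ≢ x → w ≢ y → w ≡ nb φ c x → h w ≡ w
      h-old {w} p q r with w ≟ x | w ≟ y | w ≟ nb φ c x
      ... | yes e | _     | _     = contradiction e p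
      ... | no _  | yes e | _     = contradiction e q
      ... | no _  | no _  | yes _ = refl
      ... | no _  | no _  | no e  = contradiction r e

      h-rest : ∀ {w} → w ≢ x → w ≢ y → w ≢ nb φ c x → h w ≡ nb φ c w
      h-rest {w} p q r with w ≟ x | w ≟ y | w ≟ nb φ c x
      ... | yes e | _     | _     = contradiction e p
      ... | no _  | yes e | _     = contradiction e q
      ... | no _  | no _  | yes e = contradiction e r
      ... | no _  | no _  | no _  = refl

      data View (w : Fin n) : Set where
        at-x : w ≡ x → h w ≡ y → View w
        at-y : w ≡ y → h w ≡ x → View w
        old  : w ≢ x → w ≢ y → w ≡ nb φ c x → h w ≡ w → View w
        rest : w ≢ x → w ≢ y → w ≢ nb φ c x → h w ≡ nb φ c w → View w

      view : ∀ w → View w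
      view w = go (w ≟ x) (w ≟ y) (w ≟ nb φ c x)
        where
        go : Dec (w ≡ x) → Dec (w ≡ y) → Dec (w ≡ nb φ c x) → View w
        go (yes refl) _ _ = at-x refl h-x
        go (no _) (yes refl) _ = at-y refl h-y
        go (no p) (no q) (yes r) = old p q r (h-old p q r)
        go (no p) (no q) (no r) = rest p q r (h-rest p q r)

      h-invol : ∀ w → h (h w) ≡ w
      h-invol w with view w
      ... | at-x refl e = trans (cong h e) h-y
      ... | at-y refl e = trans (cong h e) h-x
      ... | old p q r e = trans (cong h e) e
      ... | rest p q r e = trans (cong h e) (trans (h-rest
              (λ e′ → r (≡-sym (nb-flip φ e′)))
              (λ e′ → q (trans (≡-sym (nb-flip φ e′)) cy))
              (λ e′ → p (nb-inj φ c e′))) (invol φ c w))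

      h-edge : ∀ {w} → h w ≢ w → Adj G w (h w)
      h-edge {w} ne with view w
      ... | at-x refl e = subst (Adj G w) (≡-sym e) xy
      ... | at-y refl e = subst (Adj G w) (≡-sym e) (Adj-sym G xy)
      ... | old p q r e = contradiction e ne
      ... | rest p q r e = subst (Adj G w) (≡-sym e) (edge φ (λ e′ → ne (trans e e′)))

      h-uniq : ∀ {d w} → h w ≢ w → nb φ d w ≡ h w → d ≡ c
      h-uniq {d} {w} ne eq with view w
      ... | at-x refl e = contradiction (trans eq e) (un d)
      ... | at-y refl e = contradiction (nb-flip φ (trans eq e)) (un d)
      ... | old p q r e = contradiction e ne
      ... | rest p q r e = uniq φ (λ e′ → ne (trans (≡-sym eq) e′)) (trans eq e)

      new : Fin k → Fin n → Fin n
      new d w with d ≟ c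
      ... | yes _ = h w
      ... | no _  = nb φ d w

      new-c : ∀ w → new c w ≡ h w
      new-c w with c ≟ c
      ... | yes _ = refl
      ... | no p = contradiction refl p

      new-other : ∀ {d} w → d ≢ c → new d w ≡ nb φ d w
      new-other {d} w p with d ≟ c
      ... | yes e = contradiction e p
      ... | no _ = refl

      φ′ : PartialColouring
      φ′ = record { nb = new ; invol = inv ; edge = λ {d} → ed d ; uniq = λ {d} {d′} → un′ d d′ }
        where
        inv : ∀ d w → new d (new d w) ≡ w
        inv d w with d ≟ c
        ... | yes _ = h-invol w
        ... | no _ = invol φ d w
        ed : ∀ d {w} → new d w ≢ w → Adj G w (new d w)
        ed d with d ≟ c
        ... | yes _ = h-edge
        ... | no _ = edge φ
        un′ : ∀ d d′ {w} → new d w ≢ w → new d w ≡ new d′ w → d ≡ d′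
        un′ d d′ ne e with d ≟ c | d′ ≟ c
        ... | yes refl | yes refl = refl
        ... | yes refl | no _ = ≡-sym (h-uniq ne (≡-sym e))
        ... | no _ | yes refl = h-uniq (λ e′ → ne (trans e e′)) e
        ... | no _ | no _ = uniq φ ne e

      col-xy : Col φ′ x y
      col-xy = c , trans (new-c x) h-x

      col-yx : Col φ′ y x
      col-yx = c , trans (new-c y) h-y

      good : AllBut x y φ → AllBut x (nb φ c x) φ′
      good g u v uv with g u v uv
      ... | inj₂ (inj₁ (refl , refl)) = inj₁ col-xy
      ... | inj₂ (inj₂ (refl , refl)) = inj₁ col-yx
      ... | inj₁ (d , e) with d ≟ c
      ...   | no p = inj₁ (d , trans (new-other u p) e)
      ...   | yes refl with view u
      ...     | at-x refl _ = inj₂ (inj₁ (refl , ≡-sym e))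
      ...     | at-y refl _ = ⊥-elim (Adj-irrefl G (subst (Adj G u) (trans (≡-sym e) cy) uv))
      ...     | old p q r _ = inj₂ (inj₂ (r , trans (≡-sym e) (nb-flip φ (≡-sym r))))
      ...     | rest p q r e′ = inj₁ (c , trans (new-c u) (trans e′ e))

    -- The pair exempted by `AllBut x x` is a loop, which is never an edge, so every edge is
    -- coloured.
    full⇒colouring : ∀ {x} φ → AllBut x x φ → EdgeColouring (Adj G) k
    full⇒colouring {x} φ g = record { col = λ u v e → proj₁ (c u v e) ; sym = sy ; proper = pr }
      where
      c : ∀ u v → Adj G u v → Col φ u v
      c u v e with g u v e
      ... | inj₁ p = p
      ... | inj₂ (inj₁ (refl , refl)) = ⊥-elim (Adj-irrefl G e)
      ... | inj₂ (inj₂ (refl , refl)) = ⊥-elim (Adj-irrefl G e)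
      sy : ∀ u v e e′ → proj₁ (c u v e) ≡ proj₁ (c v u e′)
      sy u v e e′ with c u v e | c v u e′
      ... | a , p | b , q = uniq φ (λ r → Adj-irrefl G (subst (λ w → Adj G w v) (trans (≡-sym r) p) e))
          (trans p (≡-sym (nb-flip φ q)))
      pr : ∀ u v w e e′ → v ≢ w → proj₁ (c u v e) ≢ proj₁ (c u w e′)
      pr u v w e e′ ne eq with c u v e | c u w e′
      pr u v w e e′ ne refl | a , p | b , q = ne (trans (≡-sym p) q)

    module FromEdgeColouring (x y : Fin n) (κ : EdgeColouring (AdjMinus G x y) k) where
      open EdgeColouring κ renaming (col to κ-col; sym to κ-sym; proper to κ-proper)

      E : Fin n → Fin n → Set
      E = AdjMinus G x y

      E? : ∀ u v → Dec (E u v)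
      E? u v = Adj? G u v ×-dec ¬? ((u ≟ x ×-dec v ≟ y) ⊎-dec (u ≟ y ×-dec v ≟ x))

      E-sym : ∀ {u v} → E u v → E v u
      E-sym (p , q) = Adj-sym G p , λ { (inj₁ (a , b)) → q (inj₂ (b , a)) ; (inj₂ (a , b)) → q (inj₁ (b , a)) }

      Has : Fin k → Fin n → Fin n → Set
      Has c u v = Σ (E u v) λ e → κ-col u v e ≡ c

      -- `κ-col` takes a proof of the edge as an argument. Going through the reversed edge by
      -- symmetry twice shows that its value does not depend on that proof, so testing one proof
      -- decides the question.
      Has? : ∀ c u v → Dec (Has c u v)
      Has? c u v with E? u v
      ... | no ¬e = no (¬e ∘ proj₁)
      ... | yes e with κ-col u v e ≟ c
      ...   | yes p = yes (e , p)
      ...   | no ¬p = no λ { (e′ , q) → ¬p (trans (κ-sym u v e (E-sym e))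
          (trans (≡-sym (κ-sym u v e′ (E-sym e))) q)) }

      Has-sym : ∀ {c u v} → Has c u v → Has c v u
      Has-sym {c} {u} {v} (e , p) = E-sym e , trans (≡-sym (κ-sym u v e (E-sym e))) p

      Has-fun : ∀ {c u v w} → Has c u v → Has c u w → v ≡ w
      Has-fun {c} {u} {v} {w} (e , p) (e′ , q) with v ≟ w
      ... | yes r = r
      ... | no r = contradiction (trans p (≡-sym q)) (κ-proper u v w e e′ r)

      Has-same : ∀ {c d u v} → Has c u v → Has d u v → c ≡ d
      Has-same {c} {d} {u} {v} (e , p) (e′ , q) = trans (≡-sym p)
          (trans (κ-sym u v e (E-sym e)) (trans (≡-sym (κ-sym u v e′ (E-sym e))) q))

      new : Fin k → Fin n → Fin n
      new c u with any? (Has? c u)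
      ... | yes (v , _) = v
      ... | no _ = u

      new-Has : ∀ {c u v} → Has c u v → new c u ≡ v
      new-Has {c} {u} h with any? (Has? c u)
      ... | yes (w , h′) = Has-fun h′ h
      ... | no ¬h = contradiction (_ , h) ¬h

      new-moved : ∀ {c u} → new c u ≢ u → Has c u (new c u)
      new-moved {c} {u} ne with any? (Has? c u)
      ... | yes (w , h′) = h′
      ... | no ¬h = contradiction refl ne

      φ : PartialColouring
      φ = record
        { nb = new
        ; invol = inv
        ; edge = λ ne → proj₁ (proj₁ (new-moved ne))
        ; uniq = λ {c} {d} {v} ne e → Has-same (subst (Has c v) e (new-moved ne))
            (new-moved (λ r → ne (trans e r)))
        }
        where
        inv : ∀ c v → new c (new c v) ≡ v
        inv c v with new c v ≟ v
        ... | yes e = trans (cong (new c) e) e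
        ... | no ne = new-Has (Has-sym (new-moved ne))

      good : AllBut x y φ
      good u v uv with (u ≟ x ×-dec v ≟ y) ⊎-dec (u ≟ y ×-dec v ≟ x)
      ... | yes s = inj₂ s
      ... | no ¬s = inj₁ (κ-col u v (uv , ¬s) , new-Has ((uv , ¬s) , refl))

  -- Fans and low vertices

  sum-tabulate : ∀ {n} (f : Fin n → ℕ) → sumᴸ (tabulate f) ≡ sum f
  sum-tabulate {zero}  f = refl
  sum-tabulate {suc n} f = cong (f zero +_) (sum-tabulate (f ∘ suc))

  deg-# : ∀ {n} (G : Graph n) v → deg G v ≡ # (Adj? G v)
  deg-# G v = trans (cong sumᴸ (map-tabulate id (λ u → if adj G v u then 1 else 0)))
    (trans (sum-tabulate (λ u → if adj G v u then 1 else 0)) (sum-cong-≗ (λ u → pt (adj G v u))))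
    where
    pt : ∀ b → (if b then 1 else 0) ≡ ind (b 𝔹.≟ true)
    pt true  = refl
    pt false = refl

  -- Low vertices and the bound from Vizing fans

  module Low {n : ℕ} (G : Graph n) (k q : ℕ) where

    -- The bound deg z ≤ (1 - 1/q) k, cleared of the fraction and the subtraction.
    Low : Fin n → Set
    Low z = q * deg G z + k ≤ q * k

    Low? : ∀ z → Dec (Low z)
    Low? z = q * deg G z + k ≤? q * k

    ℓ : Fin n → ℕ
    ℓ y = # (λ z → Adj? G y z ×-dec Low? z)

  module Fans {n : ℕ} (G : Graph n) (k q : ℕ) (deg≤k : ∀ v → deg G v ≤ k)
    (uncolourable : ¬ EdgeColouring (Adj G) k) where
    open Colouring G k public
    open Low G k q public

    -- A colour on xy would make `φ` a colouring of the whole graph, so the edge exempted by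
    -- `AllBut` really has no colour.
    uncoloured : ∀ {x y} φ → AllBut x y φ → ∀ d → nb φ d x ≢ y
    uncoloured {x} {y} φ g d e = uncolourable (full⇒colouring {x} φ g′)
      where
      g′ : AllBut x x φ
      g′ u v uv with g u v uv
      ... | inj₁ p = inj₁ p
      ... | inj₂ (inj₁ (refl , refl)) = inj₁ (d , e)
      ... | inj₂ (inj₂ (refl , refl)) = inj₁ (d , nb-flip φ e)

    miss+deg : ∀ φ v → k ≤ # (λ c → nb φ c v ≟ v) + deg G v
    miss+deg φ v = begin
      k ≡⟨ #-compl (λ c → nb φ c v ≟ v) ⟨
      # (λ c → nb φ c v ≟ v) + # (λ c → ¬? (nb φ c v ≟ v))
        ≤⟨ ℕₚ.+-monoʳ-≤ _ (#-inj (λ c → ¬? (nb φ c v ≟ v)) (Adj? G v) (λ c _ → nb φ c v) (λ c → edge φ)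
            (λ p _ → uniq φ p)) ⟩
      # (λ c → nb φ c v ≟ v) + # (Adj? G v) ≡⟨ cong (# (λ c → nb φ c v ≟ v) +_) (deg-# G v) ⟨
      # (λ c → nb φ c v ≟ v) + deg G v ∎
      where open ≤-Reasoning

    low-miss : ∀ φ {z} → Low z → k ≤ q * # (λ c → nb φ c z ≟ z)
    low-miss φ {z} low = ℕₚ.+-cancelˡ-≤ (q * deg G z) k _ (begin
      q * deg G z + k ≤⟨ low ⟩
      q * k ≤⟨ ℕₚ.*-monoʳ-≤ q (miss+deg φ z) ⟩
      q * (M + deg G z) ≡⟨ ℕₚ.*-distribˡ-+ q M (deg G z) ⟩
      q * M + q * deg G z ≡⟨ ℕₚ.+-comm (q * M) _ ⟩
      q * deg G z + q * M ∎)
      where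
      open ≤-Reasoning
      M : ℕ
      M = # (λ c → nb φ c z ≟ z)

    -- The colours present at y lead injectively to neighbours other than x, of which there are
    -- fewer than k.
    missing-colour : ∀ {x y} φ → AllBut x y φ → Adj G x y → ∃[ μ ] Miss φ μ y
    missing-colour {x} {y} φ g xy with any? (λ c → nb φ c y ≟ y)
    ... | yes p = p
    ... | no ¬p = contradiction (deg≤k y) (ℕₚ.<⇒≱ (begin-strict
        k ≡⟨ #-all (λ c → ¬? (nb φ c y ≟ y)) (λ c e → ¬p (c , e)) ⟨
        # (λ c → ¬? (nb φ c y ≟ y)) ≤⟨ #-inj (λ c → ¬? (nb φ c y ≟ y)) (λ v → Adj? G y v ×-dec ¬? (v ≟ x))
            (λ c _ → nb φ c y)
             (λ c p → edge φ p , λ e → uncoloured φ g c (nb-flip φ e)) (λ p _ → uniq φ p) ⟩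
        # (λ v → Adj? G y v ×-dec ¬? (v ≟ x)) <⟨ #-∖< (Adj? G y) x (Adj-sym G xy) ⟩
        # (Adj? G y) ≡⟨ deg-# G y ⟨
        deg G y ∎))
      where open ≤-Reasoning

    -- Averages the sizes of the missing colour sets: each low vertex misses at least k / q colours.
    abstract
      share : ∀ φ {r} (zs : Fin r → Fin n) → (∀ j → Low (zs j)) → ∀ F m → q * (r * length F + k * m) < r * k →
        ∃[ γ ] (γ ∉ F × m < # (λ j → nb φ γ (zs j) ≟ zs j))
      share φ {r} zs low F m big with any? (λ γ → ¬? (γ ∈? F) ×-dec (m ℕ.<? # (λ j → nb φ γ (zs j) ≟ zs j)))
      ... | yes p = p
      ... | no ¬p = contradiction big (ℕₚ.≤⇒≯ (begin
          r * k ≡⟨ sum-const r k ⟨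
          sum {r} (λ _ → k) ≤⟨ sum-mono (λ j → low-miss φ (low j)) ⟩
          sum (λ j → q * # (λ c → nb φ c (zs j) ≟ zs j))
              ≡⟨ *-distribˡ-sum q (λ j → # (λ c → nb φ c (zs j) ≟ zs j)) ⟨
          q * sum (λ j → # (λ c → nb φ c (zs j) ≟ zs j))
              ≡⟨ cong (q *_) (#-swap (λ j c → nb φ c (zs j) ≟ zs j)) ⟩
          q * sum cnt ≤⟨ ℕₚ.*-monoʳ-≤ q (begin
             sum cnt ≤⟨ sum-mono bound ⟩
             sum (λ γ → r * ind (γ ∈? F) + m) ≡⟨ ∑-distrib-+ (λ γ → r * ind (γ ∈? F)) (λ _ → m) ⟩
             sum (λ γ → r * ind (γ ∈? F)) + sum {k} (λ _ → m)
                 ≡⟨ cong₂ _+_ (≡-sym (*-distribˡ-sum r (λ γ → ind (γ ∈? F)))) (sum-const k m) ⟩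
             r * # (_∈? F) + k * m ≤⟨ ℕₚ.+-monoˡ-≤ (k * m) (ℕₚ.*-monoʳ-≤ r (#-∈ F)) ⟩
             r * length F + k * m ∎) ⟩
          q * (r * length F + k * m) ∎))
        where
        open ≤-Reasoning
        cnt : Fin k → ℕ
        cnt γ = # (λ j → nb φ γ (zs j) ≟ zs j)
        bound : ∀ γ → cnt γ ≤ r * ind (γ ∈? F) + m
        -- A forbidden colour may be missing at all r vertices; any other is, by assumption, missing
        -- at no more than m of them.
        bound γ with γ ∈? F
        ... | yes _ = ≤-trans (#≤n (λ j → nb φ γ (zs j) ≟ zs j))
            (≤-trans (≤-reflexive (≡-sym (ℕₚ.*-identityʳ r))) (ℕₚ.m≤m+n (r * 1) m))
        ... | no γ∉ = ≤-trans (ℕₚ.≮⇒≥ (λ lt → ¬p (γ , γ∉ , lt))) (ℕₚ.m≤n+m m (r * 0))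

    -- If `μ` were missing at both ends of yz, recolouring yz from `a` to `μ` would free `a` at y.
    -- It is also missing at x, so xy could take it and every edge would be coloured.
    fan₁ : ∀ {x y z a μ} φ → AllBut x y φ → Adj G x y → Miss φ a x → nb φ a y ≡ z → y ≢ z → Miss φ μ y →
        ¬ Miss φ μ z
    fan₁ {x} {y} {z} {a} {μ} φ g xy ax az y≢z μy μz =
      uncolourable (full⇒colouring {x} S.φ′ (subst (λ w → AllBut x w S.φ′) ax′ (S.good g′)))
      where
      φ′ = recolour φ az y≢z μy μz
      g′ = recolour-good φ az y≢z μy μz g
      x≢z : x ≢ z
      x≢z refl = uncoloured φ g a (nb-flip φ az)
      x≢y : x ≢ y
      x≢y refl = Adj-irrefl G xy
      ax′ : nb φ′ a x ≡ x
      ax′ = trans (recolour-away φ az y≢z μy μz a x≢y x≢z) ax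
      module S = Shift φ′ xy (uncoloured φ′ g′) a (recolour-y φ az y≢z μy μz)

    -- The missing colour μ of y is made missing at z₁ or z₂ by a Kempe change away from y.
    fan₂ : ∀ {x y z₁ z₂ a₁ a₂ γ} φ → AllBut x y φ → Adj G x y → Miss φ a₁ x → Miss φ a₂ x →
      nb φ a₁ y ≡ z₁ → nb φ a₂ y ≡ z₂ → y ≢ z₁ → y ≢ z₂ → z₁ ≢ z₂ → Miss φ γ z₁ → ¬ Miss φ γ z₂
    fan₂ {x} {y} {z₁} {z₂} {a₁} {a₂} {γ} φ g xy a₁x a₂x e₁ e₂ y≢z₁ y≢z₂ z₁≢z₂ γz₁ γz₂ with missing-colour φ g xy
    ... | μ , μy = go (z₁ ≟ K.end)
      where
      module K = Kempe (kempe φ y μ γ μy)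
      finish : ∀ {z a} → Miss φ a x → nb φ a y ≡ z → y ≢ z → Miss φ γ z → z ≢ K.end → ⊥
      finish {z} {a} ax az y≢z γz z≢e = fan₁ K.φ′ (K.good g) xy
        (trans (K.other x a≢μ a≢γ) ax) (trans (K.start a) az) y≢z (trans (K.start μ) μy)
        (K.out (λ e → y≢z (≡-sym e)) z≢e (inj₂ γz) γz)
        where
        a≢μ : a ≢ μ
        a≢μ refl = y≢z (trans (≡-sym μy) az)
        a≢γ : a ≢ γ
        a≢γ refl = y≢z (trans (≡-sym (nb-flip φ az)) γz)
      go : Dec (z₁ ≡ K.end) → ⊥
      go (no p) = finish a₁x e₁ y≢z₁ γz₁ p
      go (yes p) = finish a₂x e₂ y≢z₂ γz₂ (λ p′ → z₁≢z₂ (trans p (≡-sym p′)))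

    abstract
      -- Each of the q + 1 low vertices misses at least k / q colours, more than k in total, so two
      -- of them miss a common colour, against `fan₂`.
      fan-bound : ∀ {x y} φ → AllBut x y φ → Adj G x y → (bs : Fin (suc q) → Fin k) → Inj bs →
        (∀ s → Miss φ (bs s) x) → (∀ s → nb φ (bs s) y ≢ y) → ¬ (∀ s → Low (nb φ (bs s) y))
      fan-bound {x} {y} φ g xy bs bs-inj miss moved low
        with share φ (λ s → nb φ (bs s) y) low [] 1 (begin-strict
          q * (suc q * 0 + k * 1) ≡⟨ cong (q *_) (cong₂ _+_ (ℕₚ.*-zeroʳ (suc q)) (ℕₚ.*-identityʳ k)) ⟩
          q * k <⟨ ℕₚ.m<n+m (q * k) (k>0 (bs zero)) ⟩
          suc q * k ∎)
        where
        open ≤-Reasoning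
        k>0 : Fin k → 0 < k
        k>0 zero = s≤s z≤n
        k>0 (suc _) = s≤s z≤n
      ... | γ , _ , lt with #-extract (λ s → nb φ γ (nb φ (bs s) y) ≟ nb φ (bs s) y) lt
      ...   | h , h-inj , ok = fan₂ φ g xy (miss (h zero)) (miss (h (suc zero))) refl refl
                (λ e → moved _ (≡-sym e)) (λ e → moved _ (≡-sym e))
                (λ e → 0≢1 (h-inj (bs-inj (uniq φ (moved _) e)))) (ok zero) (ok (suc zero))
        where
        0≢1 : _≢_ {A = Fin 2} zero (suc zero)
        0≢1 ()

    -- The colours from y to low vertices that `fan-bound` does not limit: they are present at x,
    -- where they can be shifted onto xy.
    Hit : PartialColouring → Fin n → Fin n → Fin k → Set
    Hit φ x y c = ¬ Miss φ c x × nb φ c y ≢ y × Low (nb φ c y)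

    Hit? : ∀ φ x y c → Dec (Hit φ x y c)
    Hit? φ x y c = ¬? (nb φ c x ≟ x) ×-dec ¬? (nb φ c y ≟ y) ×-dec Low? (nb φ c y)

    -- The low neighbours of y are sorted by the colour leading to them: at most q of these colours
    -- are missing at x, and the others are hits. The extra 1 is for x itself, since xy has no
    -- colour.
    ℓ-bound : ∀ {x y} φ → AllBut x y φ → Adj G x y → ℓ y ≤ suc (q + # (Hit? φ x y))
    ℓ-bound {x} {y} φ g xy = begin
      ℓ y ≤⟨ #-∖ (λ z → Adj? G y z ×-dec Low? z) x ⟩
      suc (# (λ z → (Adj? G y z ×-dec Low? z) ×-dec ¬? (z ≟ x)))
        ≤⟨ s≤s (#-inj (λ z → (Adj? G y z ×-dec Low? z) ×-dec ¬? (z ≟ x)) toLow? (λ z p → proj₁ (colour z p))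
             (λ z p → moved z p , subst Low (≡-sym (proj₂ (colour z p))) (proj₂ (proj₁ p)))
             (λ {z} {z′} p p′ e → trans (≡-sym (proj₂ (colour z p)))
                 (trans (cong (λ c → nb φ c y) e) (proj₂ (colour z′ p′))))) ⟩
      suc (# toLow?) ≤⟨ s≤s (#-cover toLow? miss? (Hit? φ x y) split) ⟩
      suc (# miss? + # (Hit? φ x y)) ≤⟨ s≤s (ℕₚ.+-monoˡ-≤ _ (ℕₚ.≮⇒≥ few)) ⟩
      suc (q + # (Hit? φ x y)) ∎
      where
      open ≤-Reasoning
      toLow? : ∀ c → Dec (nb φ c y ≢ y × Low (nb φ c y))
      toLow? c = ¬? (nb φ c y ≟ y) ×-dec Low? (nb φ c y)
      miss? : ∀ c → Dec (Miss φ c x × nb φ c y ≢ y × Low (nb φ c y))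
      miss? c = (nb φ c x ≟ x) ×-dec toLow? c
      colour : ∀ z → (Adj G y z × Low z) × z ≢ x → Col φ y z
      colour z ((yz , _) , z≢x) with g y z yz
      ... | inj₁ p = p
      ... | inj₂ (inj₁ (refl , refl)) = ⊥-elim (Adj-irrefl G yz)
      ... | inj₂ (inj₂ (_ , refl)) = contradiction refl z≢x
      moved : ∀ z p → nb φ (proj₁ (colour z p)) y ≢ y
      moved z p e = Adj-irrefl G (subst (Adj G y) (trans (≡-sym (proj₂ (colour z p))) e) (proj₁ (proj₁ p)))
      split : ∀ c → nb φ c y ≢ y × Low (nb φ c y) → (Miss φ c x × nb φ c y ≢ y × Low (nb φ c y)) ⊎ Hit φ x y c
      split c p with nb φ c x ≟ x
      ... | yes m = inj₁ (m , p)
      ... | no ¬m = inj₂ (¬m , p)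
      few : ¬ (suc q ≤ # miss?)
      few le with #-extract miss? le
      ... | bs , bs-inj , ok = fan-bound φ g xy bs bs-inj (proj₁ ∘ ok) (proj₁ ∘ proj₂ ∘ ok) (proj₂ ∘ proj₂ ∘ ok)

    abstract
      -- Recolouring y₀z from `c` to `α` frees `c` at y₀, after which xy₀ can take `c` from the edge
      -- at x that has it. Only `c` and `α` are touched, so whatever was arranged in other colours
      -- survives.
      reach : ∀ {x y₀ z c α} φ → AllBut x y₀ φ → Adj G x y₀ → Miss φ α y₀ → Miss φ α z → nb φ c y₀ ≡ z →
          y₀ ≢ z →
        Σ PartialColouring λ φ′ → AllBut x (nb φ c x) φ′ × (∀ {d} v → d ≢ c → d ≢ α → nb φ′ d v ≡ nb φ d v)
      reach {x} {y₀} {z} {c} {α} φ g xy αy αz cz y₀≢z =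
        S.φ′ , subst (λ w → AllBut x w S.φ′) cx (S.good g₁) ,
        (λ v d≢c d≢α → trans (S.new-other v d≢c) (recolour-other φ cz y₀≢z αy αz v d≢c d≢α))
        where
        φ₁ : PartialColouring
        φ₁ = recolour φ cz y₀≢z αy αz
        g₁ : AllBut x y₀ φ₁
        g₁ = recolour-good φ cz y₀≢z αy αz g
        x≢z : x ≢ z
        x≢z refl = uncoloured φ g c (nb-flip φ cz)
        x≢y : x ≢ y₀
        x≢y refl = Adj-irrefl G xy
        cx : nb φ₁ c x ≡ nb φ c x
        cx = recolour-away φ cz y₀≢z αy αz c x≢y x≢z
        module S = Shift φ₁ xy (uncoloured φ₁ g₁) c (recolour-y φ cz y₀≢z αy αz)

  -- Freeing colours at x

  big-fibre : ∀ {N p} q (i : Fin N → Fin p) → p * q < N → ∃[ j ] Σ (Fin (suc q) → Fin N) λ h → Inj h ×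
      (∀ s → i (h s) ≡ j)
  big-fibre {N} {p} q i lt with sum-pigeonhole {m = q} (λ j → # (λ s → i s ≟ j)) (begin-strict
      p * q <⟨ lt ⟩
      N ≡⟨ trans (sum-const N 1) (ℕₚ.*-identityʳ N) ⟨
      sum {N} (λ _ → 1) ≤⟨ sum-mono (λ s → ≤-trans (s≤s z≤n) (#-∖< (λ j → i s ≟ j) (i s) refl)) ⟩
      sum (λ s → # (λ j → i s ≟ j)) ≡⟨ #-swap (λ s j → i s ≟ j) ⟩
      sum (λ j → # (λ s → i s ≟ j)) ∎)
    where open ≤-Reasoning
  ... | j , lt′ = j , #-extract (λ s → i s ≟ j) lt′

  -- `f` bounds how many colours are protected at a time; `k-large` makes k large enough for `share`
  -- and `free-colour` to steer clear of them.
  module Processing {n : ℕ} (G : Graph n) (k q : ℕ) (deg≤k : ∀ v → deg G v ≤ k)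
    (uncolourable : ¬ EdgeColouring (Adj G) k)
    (f : ℕ) (k-large : q * (suc (2 * q) * f) < k) {x : Fin n} (low-x : q * deg G x + k ≤ q * k) where
    open Fans G k q deg≤k uncolourable

    Agree : List (Fin k) → PartialColouring → PartialColouring → Set
    Agree F φ φ′ = ∀ {c} v → c ∈ F → nb φ′ c v ≡ nb φ c v

    abstract
      free-colour : ∀ φ F → length F ≤ f → ∃[ β ] (β ∉ F × Miss φ β x)
      free-colour φ F le with any? (λ β → ¬? (β ∈? F) ×-dec (nb φ β x ≟ x))
      ... | yes p = p
      ... | no ¬p = contradiction k-large (ℕₚ.≤⇒≯ (begin
          k ≤⟨ low-miss φ low-x ⟩
          q * # (λ c → nb φ c x ≟ x) ≤⟨ ℕₚ.*-monoʳ-≤ q (begin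
            # (λ c → nb φ c x ≟ x) ≤⟨ #-mono (λ c → nb φ c x ≟ x) (_∈? F) inF ⟩
            # (_∈? F) ≤⟨ #-∈ F ⟩
            length F ≤⟨ le ⟩
            f ≤⟨ ℕₚ.m≤m+n f (2 * q * f) ⟩
            suc (2 * q) * f ∎) ⟩
          q * (suc (2 * q) * f) ∎))
        where
        open ≤-Reasoning
        inF : ∀ c → Miss φ c x → c ∈ F
        inF c m with c ∈? F
        ... | yes i = i
        ... | no i = contradiction (c , i , m) ¬p

    module _ {p : ℕ} (y₀ : Fin n) (ys : Fin p → Fin n) (ys-inj : Inj ys) where

      -- From 2q + 1 low vertices, each missing at least k / q colours, averaging yields a colour
      -- missing at three, and each of two Kempe changes spoils at most one. Differing from x keeps
      -- such a vertex from being the start of the chains, which begin at x.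
      Todo : PartialColouring → Fin k → Set
      Todo φ d = Σ (Fin (suc (2 * q)) → Fin p) λ g → Inj g ×
        (∀ i → Low (nb φ d (ys (g i))) × nb φ d (ys (g i)) ≢ ys (g i) × nb φ d (ys (g i)) ≢ x)

      Done : PartialColouring → Fin k → Fin p → Set
      Done φ b i = Miss φ b x × Low (nb φ b (ys i)) × nb φ b (ys i) ≢ ys i

      Todo-agree : ∀ {φ φ′ d} → (∀ v → nb φ′ d v ≡ nb φ d v) → Todo φ d → Todo φ′ d
      Todo-agree e (g , g-inj , ok) = g , g-inj , λ i →
        let a , b , c = ok i in subst Low (≡-sym (e _)) a , (λ e′ → b (trans (≡-sym (e _)) e′)) ,
            (λ e′ → c (trans (≡-sym (e _)) e′))

      Done-agree : ∀ {φ φ′ b i} → (∀ v → nb φ′ b v ≡ nb φ b v) → Done φ b i → Done φ′ b i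
      Done-agree e (a , b , c) = trans (e _) a , subst Low (≡-sym (e _)) b , (λ e′ → c (trans (≡-sym (e _)) e′))

      record Processed (m : ℕ) (φ : PartialColouring) (F : List (Fin k)) : Set where
        field
          φ′     : PartialColouring
          good   : AllBut x y₀ φ′
          agree  : Agree F φ φ′
          bs     : Fin m → Fin k
          is     : Fin m → Fin p
          bs-inj : Inj bs
          bs∉    : ∀ s → bs s ∉ F
          done   : ∀ s → Done φ′ (bs s) (is s)

      -- A colour γ missing at three of the low vertices w is traded for a colour β missing at x; then
      -- the (β, d)-chain of x can end at only one of them, and swapping elsewhere turns d into β at another.
      abstract
        process-one : ∀ φ → AllBut x y₀ φ → ∀ d F → d ∉ F → suc (length F) ≤ f → Todo φ d →
          Processed 1 φ F
        process-one φ good d F d∉F le (g , g-inj , ok)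
          with share φ (λ i → nb φ d (ys (g i))) (proj₁ ∘ ok) (d ∷ F) 2 (begin-strict
              q * (suc (2 * q) * suc (length F) + k * 2)
                  ≤⟨ ℕₚ.*-monoʳ-≤ q (ℕₚ.+-monoˡ-≤ (k * 2) (ℕₚ.*-monoʳ-≤ (suc (2 * q)) le)) ⟩
              q * (suc (2 * q) * f + k * 2) ≡⟨ ℕₚ.*-distribˡ-+ q (suc (2 * q) * f) (k * 2) ⟩
              q * (suc (2 * q) * f) + q * (k * 2) <⟨ ℕₚ.+-monoˡ-< (q * (k * 2)) k-large ⟩
              k + q * (k * 2) ≡⟨ arith q k ⟩
              suc (2 * q) * k ∎)
          where
          open ≤-Reasoning
          arith : ∀ q k → k + q * (k * 2) ≡ suc (2 * q) * k
          arith = solve-∀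
        ... | γ , γ∉ , cnt with #-extract (λ i → nb φ γ (nb φ d (ys (g i))) ≟ nb φ d (ys (g i))) cnt
            | free-colour φ (d ∷ F) le
        ... | h , h-inj , γw | β , β∉ , βx = record
            { φ′ = K₂.φ′ ; good = K₂.good (K₁.good good) ; agree = agree
            ; bs = λ _ → β ; is = λ _ → g idx
            ; bs-inj = λ { {zero} {zero} _ → refl } ; bs∉ = λ _ → β∉ ∘ there
            ; done = λ _ → trans (K₂.start β) (trans (K₁.start β) βx) ,
                subst Low (≡-sym done) (proj₁ (ok idx)) ,
                λ e → proj₁ (proj₂ (ok idx)) (trans (≡-sym done) e) }
          where
          w : Fin (suc (2 * q)) → Fin n
          w i = nb φ d (ys (g i))
          w-inj : Inj w
          w-inj e = g-inj (ys-inj (nb-inj φ d e))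
          module K₁ = Kempe (kempe φ x β γ βx)
          avoid₁ : Σ (Fin 2 → Fin 3) λ a → Inj a × (∀ i → w (h (a i)) ≢ K₁.end)
          avoid₁ = avoid (w ∘ h) (h-inj ∘ w-inj) K₁.end
          h₁ : Fin 2 → Fin (suc (2 * q))
          h₁ = h ∘ proj₁ avoid₁
          h₁-inj : Inj h₁
          h₁-inj e = proj₁ (proj₂ avoid₁) (h-inj e)
          βw : ∀ i → Miss K₁.φ′ β (w (h₁ i))
          βw i = K₁.out (proj₂ (proj₂ (ok (h₁ i)))) (proj₂ (proj₂ avoid₁) i) (inj₂ (γw (proj₁ avoid₁ i)))
              (γw (proj₁ avoid₁ i))
          module K₂ = Kempe (kempe K₁.φ′ x β d (trans (K₁.start β) βx))
          avoid₂ : Σ (Fin 1 → Fin 2) λ a → Inj a × (∀ i → w (h₁ (a i)) ≢ K₂.end)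
          avoid₂ = avoid (w ∘ h₁) (h₁-inj ∘ w-inj) K₂.end
          idx : Fin (suc (2 * q))
          idx = h₁ (proj₁ avoid₂ zero)
          done : nb K₂.φ′ β (ys (g idx)) ≡ w idx
          done = K₂.out (proj₂ (proj₂ (ok idx))) (proj₂ (proj₂ avoid₂) zero) (inj₁ (βw (proj₁ avoid₂ zero)))
            (K₁.other (ys (g idx)) (λ e → β∉ (here (≡-sym e))) (λ e → γ∉ (here (≡-sym e))))
          agree : Agree F φ K₂.φ′
          agree v c∈ = trans (K₂.other v (λ { refl → β∉ (there c∈) }) (λ { refl → d∉F c∈ }))
            (K₁.other v (λ { refl → β∉ (there c∈) }) (λ { refl → γ∉ (there c∈) }))

      -- While the first colour is processed, those still to come are protected along with `F`.
      -- Afterwards its place in the budget `f` passes to the freed `β`, so `m + length F` stays the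
      -- same in the recursion.
      process : ∀ m φ → AllBut x y₀ φ →
        (ds : Fin m → Fin k) → Inj ds → ∀ F → (∀ s → ds s ∉ F) → m + length F ≤ f → (∀ s → Todo φ (ds s)) →
        Processed m φ F
      process zero φ good ds ds-inj F ds∉F le todo = record
        { φ′ = φ ; good = good ; agree = λ v _ → refl
        ; bs = λ () ; is = λ () ; bs-inj = λ { {()} } ; bs∉ = λ () ; done = λ () }
      process (suc m) φ good ds ds-inj F ds∉F le todo = record
        { φ′ = R.φ′ ; good = R.good
        ; agree = λ v c∈ → trans (R.agree v (there c∈)) (S.agree v (∈-++⁺ʳ later c∈))
        ; bs = bs ; is = is ; bs-inj = bs-inj ; bs∉ = bs∉ ; done = done }
        where
        later : List (Fin k)
        later = tabulate (ds ∘ suc)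
        0≢suc : ∀ {s : Fin m} → _≢_ {A = Fin (suc m)} zero (suc s)
        0≢suc ()
        ds₀∉ : ds zero ∉ later ++ F
        ds₀∉ p = [ (λ q → 0≢suc (ds-inj (proj₂ (∈-tabulate⁻ q)))) , ds∉F zero ]′ (∈-++⁻ later p)
        len : suc (length (later ++ F)) ≤ f
        len = ≤-trans (≤-reflexive (cong suc (trans (length-++ later)
            (cong (_+ length F) (length-tabulate (ds ∘ suc)))))) le
        module S = Processed (process-one φ good (ds zero) (later ++ F) ds₀∉ len (todo zero))
        β : Fin k
        β = S.bs zero
        ds∉ : ∀ s → ds (suc s) ∉ β ∷ F
        ds∉ s (here e) = S.bs∉ zero (∈-++⁺ˡ (subst (_∈ later) e (∈-tabulate⁺ s)))
        ds∉ s (there p) = ds∉F (suc s) p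
        module R = Processed (process m S.φ′ S.good (ds ∘ suc) (λ e → suc-injective (ds-inj e)) (β ∷ F) ds∉
          (≤-trans (≤-reflexive (ℕₚ.+-suc m (length F))) le)
          (λ s → Todo-agree {φ} {S.φ′} (λ v → S.agree v (∈-++⁺ˡ (∈-tabulate⁺ s))) (todo (suc s))))
        bs : Fin (suc m) → Fin k
        bs zero = β
        bs (suc s) = R.bs s
        is : Fin (suc m) → Fin p
        is zero = S.is zero
        is (suc s) = R.is s
        bs-inj : Inj bs
        bs-inj {zero} {zero} e = refl
        bs-inj {zero} {suc t} e = contradiction (here (≡-sym e)) (R.bs∉ t)
        bs-inj {suc s} {zero} e = contradiction (here e) (R.bs∉ s)
        bs-inj {suc s} {suc t} e = cong suc (R.bs-inj e)
        bs∉ : ∀ s → bs s ∉ F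
        bs∉ zero p = S.bs∉ zero (∈-++⁺ʳ later p)
        bs∉ (suc s) p = R.bs∉ s (there p)
        done : ∀ s → Done R.φ′ (bs s) (is s)
        done zero = Done-agree {S.φ′} {R.φ′} (λ v → R.agree v (here refl)) (S.done zero)
        done (suc s) = R.done s

    -- Changing only the colours α and cs j, each edge from x to ys j can be made the uncoloured one.
    record Hub {p : ℕ} (y₀ : Fin n) (φ : PartialColouring) (α : Fin k) (cs : Fin p → Fin k) : Set where
      field
        good   : AllBut x y₀ φ
        xy₀    : Adj G x y₀
        cs-inj : Inj cs
        αy₀    : Miss φ α y₀
        αzs    : ∀ j → Miss φ α (nb φ (cs j) y₀)
        y₀≢zs  : ∀ j → y₀ ≢ nb φ (cs j) y₀
        ys≢x   : ∀ j → nb φ (cs j) x ≢ x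

      ys : Fin p → Fin n
      ys j = nb φ (cs j) x

      ys-inj : Inj ys
      ys-inj e = cs-inj (uniq φ (ys≢x _) e)

      F₀ : List (Fin k)
      F₀ = α ∷ tabulate cs

      ∣F₀∣ : length F₀ ≡ suc p
      ∣F₀∣ = cong suc (length-tabulate cs)

      cs∈ : ∀ j → cs j ∈ F₀
      cs∈ j = there (∈-tabulate⁺ j)

      abstract
        -- Only the colours in `F₀` matter for `reach`, so any later colouring that agrees with `φ`
        -- on them still allows the move.
        reach-hub : ∀ φ′ → AllBut x y₀ φ′ → Agree F₀ φ φ′ → ∀ j → Σ PartialColouring λ φ″ → AllBut x (ys j) φ″ ×
            (∀ {d} v → d ∉ F₀ → nb φ″ d v ≡ nb φ′ d v)
        reach-hub φ′ good′ agree j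
          with reach φ′ good′ xy₀ (trans (agree y₀ (here refl)) αy₀)
              (trans (agree (nb φ (cs j) y₀) (here refl)) (αzs j)) (agree y₀ (cs∈ j)) (y₀≢zs j)
        ... | φ″ , good″ , same = φ″ , subst (λ w → AllBut x w φ″) (agree x (cs∈ j)) good″ ,
              λ v d∉ → same v (λ { refl → d∉ (cs∈ j) }) (λ { refl → d∉ (here refl) })

      ys-adj : ∀ j → Adj G x (ys j)
      ys-adj j = edge φ (ys≢x j)

    -- Processing frees pq + 1 colours at x, each leading to a low vertex from one of p neighbours,
    -- so q + 1 share the same one. Making the edge from x to it the uncoloured one keeps these
    -- colours intact and contradicts `fan-bound`.
    hub-bound : ∀ {p y₀ φ α} {cs : Fin p → Fin k} (H : Hub y₀ φ α cs) → suc (p * q) + suc p ≤ f →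
      (ds : Fin (suc (p * q)) → Fin k) → Inj ds → (∀ s → ds s ∉ Hub.F₀ H) →
          ¬ (∀ s → Todo y₀ (Hub.ys H) (Hub.ys-inj H) φ (ds s))
    hub-bound {p} {y₀} {φ} {α} {cs} H le ds ds-inj ds∉ todo = contra (big-fibre q P.is ≤-refl)
      where
      open Hub H using (ys; ys-inj; F₀; ∣F₀∣; good; reach-hub; ys-adj)
      module P = Processed (process y₀ ys ys-inj (suc (p * q)) φ good ds ds-inj F₀ ds∉
          (≤-trans (≤-reflexive (cong (suc (p * q) +_) ∣F₀∣)) le) todo)
      contra : ¬ (∃[ j ] Σ (Fin (suc q) → Fin (suc (p * q))) λ h → Inj h × (∀ s → P.is (h s) ≡ j))
      contra (j , h , h-inj , h-fibre) with reach-hub P.φ′ P.good P.agree j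
      ... | φ₂ , good₂ , same = fan-bound φ₂ good₂ (ys-adj j) (P.bs ∘ h) (λ e → h-inj (P.bs-inj e))
        (λ s → trans (same x (P.bs∉ (h s))) (proj₁ (P.done (h s))))
        (λ s e → proj₂ (proj₂ (done′ s)) (trans (≡-sym (same (ys j) (P.bs∉ (h s)))) e))
        (λ s → subst Low (≡-sym (same (ys j) (P.bs∉ (h s)))) (proj₁ (proj₂ (done′ s))))
        where
        done′ : ∀ s → Done y₀ ys ys-inj P.φ′ (P.bs (h s)) j
        done′ s = subst (Done y₀ ys ys-inj P.φ′ (P.bs (h s))) (h-fibre s) (P.done (h s))

  -- Few neighbours of x see many low vertices

  -- A colour present at x is seen by at most 2q of the p neighbours unless it is popular, so with
  -- p = 4qE at least half of the incidences are on popular colours.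
  hubSize : ℕ → ℕ → ℕ
  hubSize q E = 4 * q * E

  -- With p the hub size, pq + 1 freed colours put q + 1 on one of the p neighbours. Also, among pq
  -- + 1 low vertices a colour is missing at more than p on average.
  rounds : ℕ → ℕ → ℕ
  rounds q E = suc (hubSize q E * q)

  module HubCount {n : ℕ} (G : Graph n) (k q E : ℕ) (deg≤k : ∀ v → deg G v ≤ k)
    (uncolourable : ¬ EdgeColouring (Adj G) k)
    (k-large : q * (suc (2 * q) * (rounds q E + suc (hubSize q E))) < k)
    (k-large′ : q * (rounds q E * rounds q E) < k)
    (0<q : 0 < q) (0<E : 0 < E)
    {x : Fin n} (low-x : q * deg G x + k ≤ q * k)
    (deg-large : 2 * E * (q + hubSize q E + 2 + hubSize q E * q) < deg G x) where

    private
      p N : ℕ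
      p = hubSize q E
      N = rounds q E

    open Fans G k q deg≤k uncolourable
    -- The budget covers `N` colours to be processed and the `suc p` colours of `F₀`.
    open Processing G k q deg≤k uncolourable (N + suc p) k-large low-x

    present≤deg : ∀ φ → # (λ c → ¬? (nb φ c x ≟ x)) ≤ deg G x
    present≤deg φ = ≤-trans (#-inj (λ c → ¬? (nb φ c x ≟ x)) (Adj? G x) (λ c _ → nb φ c x) (λ c → edge φ)
        (λ p _ → uniq φ p))
      (≤-reflexive (≡-sym (deg-# G x)))

    module _ {y₀ φ α} {cs : Fin p → Fin k} (H : Hub y₀ φ α cs) (bad : ∀ j → deg G x < E * ℓ (Hub.ys H j)) where
      open Hub H using (ys; ys-inj; F₀; ∣F₀∣; good; reach-hub; ys-adj; cs∈)

      Target : Fin p → Fin k → Set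
      Target j c = c ∉ F₀ × Hit φ x (ys j) c

      Target? : ∀ j c → Dec (Target j c)
      Target? j c = ¬? (c ∈? F₀) ×-dec Hit? φ x (ys j) c

      -- `ℓ-bound` is applied after the edge from x to `ys j` has been made the uncoloured one. This
      -- changes only colours in `F₀`, so all but p + 1 of the hits there are already hits in `φ`.
      ℓ≤Target : ∀ j → ℓ (ys j) ≤ suc (q + (suc p + # (Target? j)))
      ℓ≤Target j = go (reach-hub φ good (λ v _ → refl) j)
        where
        open ≤-Reasoning
        go : Σ PartialColouring (λ φ″ → AllBut x (ys j) φ″ × (∀ {d} v → d ∉ F₀ → nb φ″ d v ≡ nb φ d v)) →
            ℓ (ys j) ≤ suc (q + (suc p + # (Target? j)))
        go (φ″ , good″ , same) = begin
          ℓ (ys j) ≤⟨ ℓ-bound φ″ good″ (ys-adj j) ⟩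
          suc (q + # (Hit? φ″ x (ys j))) ≤⟨ s≤s (ℕₚ.+-monoʳ-≤ q (begin
            # (Hit? φ″ x (ys j)) ≤⟨ #-cover (Hit? φ″ x (ys j)) (_∈? F₀) (Target? j) split ⟩
            # (_∈? F₀) + # (Target? j) ≤⟨ ℕₚ.+-monoˡ-≤ _ (≤-trans (#-∈ F₀) (≤-reflexive ∣F₀∣)) ⟩
            suc p + # (Target? j) ∎)) ⟩
          suc (q + (suc p + # (Target? j))) ∎
          where
          split : ∀ c → Hit φ″ x (ys j) c → c ∈ F₀ ⊎ Target j c
          split c (a , b , l) with c ∈? F₀
          ... | yes i = inj₁ i
          ... | no i = inj₂ (i , (λ e → a (trans (same x i) e)) , (λ e → b (trans (same (ys j) i) e)) ,
              subst Low (same (ys j) i) l)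

      popular? : ∀ c → Dec (2 * q < # (λ j → Target? j c))
      popular? c = 2 * q ℕ.<? # (λ j → Target? j c)

      targets≤ : sum (λ j → # (Target? j)) ≤ 2 * q * deg G x + p * # popular?
      targets≤ = begin
        sum (λ j → # (Target? j)) ≡⟨ #-swap Target? ⟩
        sum (λ c → # (λ j → Target? j c)) ≤⟨ sum-mono bound ⟩
        sum (λ c → 2 * q * ind (¬? (nb φ c x ≟ x)) + p * ind (popular? c))
          ≡⟨ ∑-distrib-+ (λ c → 2 * q * ind (¬? (nb φ c x ≟ x))) (λ c → p * ind (popular? c)) ⟩
        sum (λ c → 2 * q * ind (¬? (nb φ c x ≟ x))) + sum (λ c → p * ind (popular? c))
          ≡⟨ cong₂ _+_ (*-distribˡ-sum (2 * q) (λ c → ind (¬? (nb φ c x ≟ x))))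
              (*-distribˡ-sum p (λ c → ind (popular? c))) ⟨
        2 * q * # (λ c → ¬? (nb φ c x ≟ x)) + p * # popular?
            ≤⟨ ℕₚ.+-monoˡ-≤ _ (ℕₚ.*-monoʳ-≤ (2 * q) (present≤deg φ)) ⟩
        2 * q * deg G x + p * # popular? ∎
        where
        open ≤-Reasoning
        bound : ∀ c → # (λ j → Target? j c) ≤ 2 * q * ind (¬? (nb φ c x ≟ x)) + p * ind (popular? c)
        bound c = go (nb φ c x ≟ x) (popular? c)
          where
          go : (d : Dec (nb φ c x ≡ x)) (e : Dec (2 * q < # (λ j → Target? j c))) →
              # (λ j → Target? j c) ≤ 2 * q * ind (¬? d) + p * ind e
          go d (yes _) = ≤-trans (#≤n (λ j → Target? j c))
              (≤-trans (≤-reflexive (≡-sym (ℕₚ.*-identityʳ p))) (ℕₚ.m≤n+m (p * 1) _))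
          go (no _) (no e) = ≤-trans (ℕₚ.≮⇒≥ e) (≤-trans (≤-reflexive (≡-sym (ℕₚ.*-identityʳ (2 * q))))
              (ℕₚ.m≤m+n (2 * q * 1) _))
          go (yes d) (no _) = ≤-trans (≤-reflexive (#-none (λ j → Target? j c) (λ j t → proj₁ (proj₂ t) d))) z≤n

      -- With at most pq popular colours, summing `bad` over the hub bounds p deg x = 4qE deg x by
      -- 2qE deg x plus a term free of deg x. Cancelling half of the left side contradicts
      -- `deg-large`.
      many-popular : N ≤ # popular?
      many-popular = ℕₚ.≰⇒> λ few → contradiction deg-large
          (ℕₚ.≤⇒≯ (ℕₚ.*-cancelˡ-≤ (2 * q * E) {{ℕ.>-nonZero
          (ℕₚ.*-mono-≤ (ℕₚ.*-mono-≤ {1} {2} {1} {q} (s≤s z≤n) 0<q) 0<E)}} (begin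
        2 * q * E * κ ≤⟨ ℕₚ.+-cancelʳ-≤ (2 * q * E * κ) _ _ (begin
          2 * q * E * κ + 2 * q * E * κ ≡⟨ ar₁ q E κ ⟩
          p * κ ≡⟨ sum-const p κ ⟨
          sum {p} (λ _ → κ) ≤⟨ sum-mono (λ j → ≤-trans (ℕₚ.<⇒≤ (bad j)) (ℕₚ.*-monoʳ-≤ E (ℓ≤Target j))) ⟩
          sum (λ j → E * suc (q + (suc p + # (Target? j))))
              ≡⟨ *-distribˡ-sum E (λ j → suc (q + (suc p + # (Target? j)))) ⟨
          E * sum (λ j → suc (q + (suc p + # (Target? j))))
              ≡⟨ cong (E *_) (trans (sum-cong-≗ (λ j → ar₂ q p (# (Target? j))))
              (trans (∑-distrib-+ {p} (λ _ → q + p + 2) (λ j → # (Target? j)))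
                  (cong (_+ sum (λ j → # (Target? j))) (sum-const p (q + p + 2))))) ⟩
          E * (p * (q + p + 2) + sum (λ j → # (Target? j)))
              ≤⟨ ℕₚ.*-monoʳ-≤ E (ℕₚ.+-monoʳ-≤ (p * (q + p + 2))
              (≤-trans targets≤ (ℕₚ.+-monoʳ-≤ _ (ℕₚ.*-monoʳ-≤ p few)))) ⟩
          E * (p * (q + p + 2) + (2 * q * κ + p * (p * q))) ≡⟨ ar₃ q E κ p ⟩
          p * (E * (q + p + 2 + p * q)) + 2 * q * E * κ ∎) ⟩
        p * (E * (q + p + 2 + p * q)) ≡⟨ ar₄ q E (q + p + 2 + p * q) ⟩
        2 * q * E * (2 * E * (q + p + 2 + p * q)) ∎)))
        where
        open ≤-Reasoning
        κ : ℕ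
        κ = deg G x
        ar₁ : ∀ q E κ → 2 * q * E * κ + 2 * q * E * κ ≡ 4 * q * E * κ
        ar₁ = solve-∀
        ar₂ : ∀ q p t → suc (q + (suc p + t)) ≡ (q + p + 2) + t
        ar₂ = solve-∀
        ar₃ : ∀ q E κ p → E * (p * (q + p + 2) + (2 * q * κ + p * (p * q))) ≡ p *
            (E * (q + p + 2 + p * q)) + 2 * q * E * κ
        ar₃ = solve-∀
        ar₄ : ∀ q E t → 4 * q * E * (E * t) ≡ 2 * q * E * (2 * E * t)
        ar₄ = solve-∀

      hub-contradiction : ⊥
      hub-contradiction = go (#-extract popular? many-popular)
        where
        go : Σ (Fin N → Fin k) (λ h → Inj h × (∀ i → 2 * q < # (λ j → Target? j (h i)))) → ⊥
        go (ds , ds-inj , pop) = hub-bound H ≤-refl ds ds-inj ds∉ todo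
          where
          js : ∀ s → Σ (Fin (suc (2 * q)) → Fin p) λ g → Inj g × (∀ i → Target (g i) (ds s))
          js s = #-extract (λ j → Target? j (ds s)) (pop s)
          ds∉ : ∀ s → ds s ∉ F₀
          ds∉ s = proj₁ (proj₂ (proj₂ (js s)) zero)
          todo : ∀ s → Todo y₀ ys ys-inj φ (ds s)
          todo s = let g , g-inj , ok = js s in g , g-inj , λ i → let _ , _ , b , l = ok i in
            -- An edge from this neighbour back to x has the colour that `cs` assigns to it, which
            -- lies in `F₀`, and targets avoid `F₀`.
            l , b , λ e → ds∉ s (subst (_∈ F₀) (uniq φ (Hub.ys≢x H (g i)) (≡-sym (nb-flip φ e))) (cs∈ (g i)))

    Mild : Fin n → Set
    Mild y = Adj G x y × E * ℓ y ≤ deg G x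

    Mild? : ∀ y → Dec (Mild y)
    Mild? y = Adj? G x y ×-dec (E * ℓ y ≤? deg G x)

    -- Discarding hits that lead from x to mild neighbours leaves `N` colours. Some `γ` is missing
    -- at p + 1 of the low vertices they reach from y₀; a Kempe change from y₀ trades it for `α` at
    -- all but one of these, which gives a hub without mild neighbours.
    no-hub : ∀ {y₀} φ → AllBut x y₀ φ → Adj G x y₀ → ¬ (N + # Mild? + suc q ≤ ℓ y₀)
    no-hub {y₀} φ good xy₀ many = start (#-extract Start? enough)
      where
      Start? : ∀ c → Dec (Hit φ x y₀ c × ¬ (E * ℓ (nb φ c x) ≤ deg G x))
      Start? c = Hit? φ x y₀ c ×-dec ¬? (E * ℓ (nb φ c x) ≤? deg G x)
      mild? : ∀ c → Dec (nb φ c x ≢ x × E * ℓ (nb φ c x) ≤ deg G x)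
      mild? c = ¬? (nb φ c x ≟ x) ×-dec (E * ℓ (nb φ c x) ≤? deg G x)
      split : ∀ c → Hit φ x y₀ c → (nb φ c x ≢ x × E * ℓ (nb φ c x) ≤ deg G x) ⊎
          (Hit φ x y₀ c × ¬ (E * ℓ (nb φ c x) ≤ deg G x))
      split c h with E * ℓ (nb φ c x) ≤? deg G x
      ... | yes m = inj₁ (proj₁ h , m)
      ... | no m = inj₂ (h , m)
      enough : N ≤ # Start?
      enough = ℕₚ.+-cancelʳ-≤ (# Mild? + suc q) N (# Start?) (begin
        N + (# Mild? + suc q) ≡⟨ ℕₚ.+-assoc N (# Mild?) (suc q) ⟨
        N + # Mild? + suc q ≤⟨ many ⟩
        ℓ y₀ ≤⟨ ℓ-bound φ good xy₀ ⟩
        suc q + # (Hit? φ x y₀) ≤⟨ ℕₚ.+-monoʳ-≤ (suc q) (#-cover (Hit? φ x y₀) mild? Start? split) ⟩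
        suc q + (# mild? + # Start?) ≤⟨ ℕₚ.+-monoʳ-≤ (suc q)
            (ℕₚ.+-monoˡ-≤ _ (#-inj mild? Mild? (λ c _ → nb φ c x)
            (λ c t → edge φ (proj₁ t) , proj₂ t) (λ t _ → uniq φ (proj₁ t)))) ⟩
        suc q + (# Mild? + # Start?) ≡⟨ ar (suc q) (# Mild?) (# Start?) ⟩
        # Start? + (# Mild? + suc q) ∎)
        where
        open ≤-Reasoning
        ar : ∀ a b c → a + (b + c) ≡ c + (b + a)
        ar = solve-∀
      start : Σ (Fin N → Fin k) (λ h → Inj h × (∀ i → Hit φ x y₀ (h i) × ¬ (E * ℓ (nb φ (h i) x) ≤ deg G x))) →
          ⊥
      start (cs , cs-inj , ok) = with-γ (share φ zs (λ j → proj₂ (proj₂ (proj₁ (ok j)))) (tabulate cs) p big)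
        where
        open ≤-Reasoning
        zs : Fin N → Fin n
        zs j = nb φ (cs j) y₀
        big : q * (N * length (tabulate cs) + k * p) < N * k
        big = begin-strict
          q * (N * length (tabulate cs) + k * p) ≡⟨ cong (λ t → q * (N * t + k * p)) (length-tabulate cs) ⟩
          q * (N * N + k * p) ≡⟨ ℕₚ.*-distribˡ-+ q (N * N) (k * p) ⟩
          q * (N * N) + q * (k * p) <⟨ ℕₚ.+-monoˡ-< (q * (k * p)) k-large′ ⟩
          k + q * (k * p) ≡⟨ ar q k p ⟩
          N * k ∎
          where
          ar : ∀ q k p → k + q * (k * p) ≡ suc (p * q) * k
          ar = solve-∀
        with-γ : ∃[ γ ] (γ ∉ tabulate cs × p < # (λ j → nb φ γ (zs j) ≟ zs j)) → ⊥
        with-γ (γ , γ∉ , cnt) = with-h (#-extract (λ j → nb φ γ (zs j) ≟ zs j) cnt) (missing-colour φ good xy₀)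
          where
          with-h : Σ (Fin (suc p) → Fin N) (λ h → Inj h × (∀ i → nb φ γ (zs (h i)) ≡ zs (h i))) →
              ∃[ α ] Miss φ α y₀ → ⊥
          with-h (h , h-inj , γz) (α , αy₀) = finish
              (avoid (zs ∘ h) (λ e → h-inj (cs-inj (uniq φ (proj₁ (proj₂ (proj₁ (ok _)))) e))) K.end)
            where
            module K = Kempe (kempe φ y₀ α γ αy₀)
            same : ∀ j v → nb K.φ′ (cs j) v ≡ nb φ (cs j) v
            same j v = K.other v (λ e → proj₁ (proj₂ (proj₁ (ok j))) (trans (cong (λ c → nb φ c y₀) e) αy₀))
              (λ e → γ∉ (subst (_∈ tabulate cs) e (∈-tabulate⁺ {f = cs} j)))
            finish : Σ (Fin p → Fin (suc p)) (λ a → Inj a × (∀ i → zs (h (a i)) ≢ K.end)) → ⊥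
            finish (a , a-inj , ≢end) = hub-contradiction hub
                (λ j → ℕₚ.≰⇒> (subst (λ y → ¬ (E * ℓ y ≤ deg G x)) (≡-sym (same (i j) x)) (proj₂ (ok (i j)))))
              where
              i : Fin p → Fin N
              i j = h (a j)
              zs≢y₀ : ∀ j → zs (i j) ≢ y₀
              zs≢y₀ j = proj₁ (proj₂ (proj₁ (ok (i j))))
              hub : Hub y₀ K.φ′ α (cs ∘ i)
              hub = record
                { good = K.good good
                ; xy₀ = xy₀
                ; cs-inj = λ e → a-inj (h-inj (cs-inj e))
                ; αy₀ = trans (K.start α) αy₀
                ; αzs = λ j → subst (λ z → nb K.φ′ α z ≡ z) (≡-sym (same (i j) y₀))
                    (K.out (zs≢y₀ j) (≢end j) (inj₂ (γz (a j))) (γz (a j)))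
                ; y₀≢zs = λ j e → zs≢y₀ j (≡-sym (trans e (same (i j) y₀)))
                ; ys≢x = λ j e → proj₁ (proj₁ (ok (i j))) (trans (≡-sym (same (i j) x)) e)
                }

  -- Constants, and spreading a low vertex over its neighbours

  module Constants (s : ℕ) where
    q E p N d₀ D₀ : ℕ
    q = suc s
    -- Fewer than s deg x / E mild neighbours then means fewer than deg x / (2s), half of the lower
    -- bound deg x / s for `ℓ y₀`.
    E = 2 * s * s
    p = hubSize q E
    N = rounds q E
    -- The first summand serves `deg-large` in `HubCount`, the second the final estimate in
    -- `spread`; the summands of `D₀` are the two lower bounds on k there.
    d₀ = suc (2 * E * (q + p + 2 + p * q) + 2 * s * (N + q))
    D₀ = suc (q * (suc (2 * q) * (N + suc p)) + q * (N * N))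

  module Spreading {n : ℕ} (G : Graph n) (k s : ℕ) (0<s : 0 < s) (deg≤k : ∀ v → deg G v ≤ k)
    (uncolourable : ¬ EdgeColouring (Adj G) k)
    (colouring : ∀ x y → Adj G x y → EdgeColouring (AdjMinus G x y) k)
    (large-deg : ∀ v → Constants.d₀ s ≤ deg G v) (k-large : Constants.D₀ s ≤ k) where
    open Constants s
    open Fans G k q deg≤k uncolourable

    -- All of N(x) serves if every `s * ℓ y` is at most deg x. Otherwise the mild neighbours serve:
    -- `no-hub` forces at least s deg x / E of them, and `s * ℓ y` is at most s deg x / E on each.
    spread : ∀ {x} → Low x → Σ (Fin n → Set) λ Q → Σ (∀ y → Dec (Q y)) λ Q? →
      0 < # Q? × (∀ y → Q y → Adj G x y × s * ℓ y ≤ # Q?)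
    spread {x} low with any? (λ y → Adj? G x y ×-dec (deg G x ℕ.<? s * ℓ y))
    ... | no small = Adj G x , Adj? G x , subst (0 <_) (deg-# G x) (≤-trans (s≤s z≤n) (large-deg x)) ,
          λ y xy → xy , ≤-trans (ℕₚ.≮⇒≥ (λ lt → small (y , xy , lt))) (≤-reflexive (deg-# G x))
    ... | yes (y₀ , xy₀ , κ<ℓ) = go (s * κ ≤? E * mild)
      where
      open ≤-Reasoning
      κ : ℕ
      κ = deg G x
      0<E : 0 < E
      0<E = ℕₚ.*-mono-≤ (ℕₚ.*-mono-≤ {1} {2} {1} {s} (s≤s z≤n) 0<s) 0<s
      module C = HubCount G k q E deg≤k uncolourable
        (≤-trans (s≤s (ℕₚ.m≤m+n (q * (suc (2 * q) * (N + suc p))) (q * (N * N)))) k-large)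
        (≤-trans (s≤s (ℕₚ.m≤n+m (q * (N * N)) (q * (suc (2 * q) * (N + suc p))))) k-large)
        (s≤s z≤n) 0<E low (≤-trans (s≤s (ℕₚ.m≤m+n (2 * E * (q + p + 2 + p * q)) (2 * s * (N + q))))
            (large-deg x))
      mild : ℕ
      mild = # C.Mild?
      0<κ : 0 < κ
      0<κ = ≤-trans (s≤s z≤n) (large-deg x)
      instance
        E≢0 : ℕ.NonZero E
        E≢0 = ℕ.>-nonZero 0<E
      go : Dec (s * κ ≤ E * mild) → Σ (Fin n → Set) λ Q → Σ (∀ y → Dec (Q y)) λ Q? → 0 < # Q? ×
          (∀ y → Q y → Adj G x y × s * ℓ y ≤ # Q?)
      go (yes le) = C.Mild , C.Mild? , pos , λ y Qy → proj₁ Qy , ℕₚ.*-cancelˡ-≤ E (begin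
          E * (s * ℓ y) ≡⟨ ar E s (ℓ y) ⟩
          s * (E * ℓ y) ≤⟨ ℕₚ.*-monoʳ-≤ s (proj₂ Qy) ⟩
          s * κ ≤⟨ le ⟩
          E * mild ∎)
        where
        ar : ∀ a b c → a * (b * c) ≡ b * (a * c)
        ar = solve-∀
        pos : 0 < mild
        pos = ℕₚ.*-cancelˡ-< E 0 mild (begin-strict
          E * 0 ≡⟨ ℕₚ.*-zeroʳ E ⟩
          0 <⟨ ℕₚ.*-mono-≤ 0<s 0<κ ⟩
          s * κ ≤⟨ le ⟩
          E * mild ∎)
      -- `ℓ y₀` exceeds deg x / s while the mild neighbours number less than half of that, and the
      -- remaining half outweighs `N + q` by the choice of `d₀`.
      go (no gt) = ⊥-elim (C.no-hub K.φ K.good xy₀ (ℕₚ.≮⇒≥ (λ lt → contradiction lower (ℕₚ.<⇒≱ (upper lt)))))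
        where
        module K = FromEdgeColouring x y₀ (colouring x y₀ xy₀)
        2sm<κ : 2 * s * mild < κ
        2sm<κ = ℕₚ.*-cancelˡ-< s _ _ (begin-strict
          s * (2 * s * mild) ≡⟨ ar s mild ⟩
          E * mild <⟨ ℕₚ.≰⇒> gt ⟩
          s * κ ∎)
          where
          ar : ∀ s mild → s * (2 * s * mild) ≡ 2 * s * s * mild
          ar = solve-∀
        lower : 2 * s * (N + q) ≤ κ
        lower = ≤-trans (ℕₚ.≤-trans (ℕₚ.m≤n+m _ (2 * E * (q + p + 2 + p * q))) (ℕₚ.n≤1+n _)) (large-deg x)
        upper : ℓ y₀ < N + mild + suc q → κ < 2 * s * (N + q)
        upper lt = ℕₚ.+-cancelʳ-< κ κ _ (begin-strict
          κ + κ <⟨ ℕₚ.+-mono-< κ<ℓ κ<ℓ ⟩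
          s * ℓ y₀ + s * ℓ y₀ ≡⟨ ar₁ s (ℓ y₀) ⟩
          2 * s * ℓ y₀ ≤⟨ ℕₚ.*-monoʳ-≤ (2 * s) (s≤s⁻¹ (≤-trans lt (≤-reflexive (ℕₚ.+-suc (N + mild) q)))) ⟩
          2 * s * (N + mild + q) ≡⟨ ar₂ s N mild q ⟩
          2 * s * (N + q) + 2 * s * mild <⟨ ℕₚ.+-monoʳ-< (2 * s * (N + q)) 2sm<κ ⟩
          2 * s * (N + q) + κ ∎)
          where
          ar₁ : ∀ s l → s * l + s * l ≡ 2 * s * l
          ar₁ = solve-∀
          ar₂ : ∀ s N mild q → 2 * s * (N + mild + q) ≡ 2 * s * (N + q) + 2 * s * mild
          ar₂ = solve-∀

  -- Bounding an independent set

  ∣S∣-# : ∀ {n} (S : Subset n) → ∣ S ∣ ≡ # (_∈ˢ? S)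
  ∣S∣-# [] = refl
  ∣S∣-# (true ∷ S) = cong suc (trans (∣S∣-# S) (sum-cong-≗ λ i → shift true S i))
    where
    shift : ∀ {n} b (S : Subset n) i → ind (i ∈ˢ? S) ≡ ind (suc i ∈ˢ? (b ∷ S))
    shift b S i with i ∈ˢ? S
    ... | yes _ = refl
    ... | no _  = refl
  ∣S∣-# (false ∷ S) = trans (∣S∣-# S) (sum-cong-≗ λ i → shift false S i)
    where
    shift : ∀ {n} b (S : Subset n) i → ind (i ∈ˢ? S) ≡ ind (suc i ∈ˢ? (b ∷ S))
    shift b S i with i ∈ˢ? S
    ... | yes _ = refl
    ... | no _  = refl

  ∈⇒≤foldr-⊔ : ∀ {x xs} → x ∈ xs → x ≤ foldr _⊔_ 0 xs
  ∈⇒≤foldr-⊔ (here refl) = ℕₚ.m≤m⊔n _ _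
  ∈⇒≤foldr-⊔ {xs = y ∷ xs} (there p) = ≤-trans (∈⇒≤foldr-⊔ p) (ℕₚ.m≤n⊔m y _)

  deg≤maxDeg : ∀ {n} (G : Graph n) v → deg G v ≤ maxDeg G
  deg≤maxDeg G v = ∈⇒≤foldr-⊔ (∈-map⁺ (deg G) (∈-allFin v))

  ∣n! : ∀ {m n} → 0 < m → m ≤ n → m ∣ n !
  ∣n! {suc m} _ le = ∣-trans (m∣m*n (m !)) (m≤n⇒m!∣n! le)

  ind-*-mono : {P Q R S : Set} (p : Dec P) (q : Dec Q) (r : Dec R) (s : Dec S) → (P → Q → R × S) →
      ind p * ind q ≤ ind r * ind s
  ind-*-mono (no _) q r s f = z≤n
  ind-*-mono (yes _) (no _) r s f = z≤n
  ind-*-mono (yes p) (yes q) (yes _) (yes _) f = ≤-refl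
  ind-*-mono (yes p) (yes q) (no ¬r) s f = contradiction (proj₁ (f p q)) ¬r
  ind-*-mono (yes p) (yes q) (yes _) (no ¬s) f = contradiction (proj₂ (f p q)) ¬s

  module Counting {n : ℕ} (G : Graph n) (k s : ℕ) (0<s : 0 < s) (deg≤k : ∀ v → deg G v ≤ k)
    (uncolourable : ¬ EdgeColouring (Adj G) k)
    (colouring : ∀ x y → Adj G x y → EdgeColouring (AdjMinus G x y) k)
    (large-deg : ∀ v → Constants.d₀ s ≤ deg G v) (k-large : Constants.D₀ s ≤ k)
    (S : Subset n) (indep : Independent G S) where
    open Constants s using (q; D₀)
    open Low G k q
    open Spreading G k s 0<s deg≤k uncolourable colouring large-deg k-large using (spread)
    open ≤-Reasoning

    W : ℕ
    W = k !

    -- The fraction 1 / ℓ(y) scaled by k!, which every positive ℓ(y) divides because ℓ(y) ≤ k. The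
    -- value is 0 where y has no low neighbour.
    weight : ∀ y → ∃[ u ] (u * ℓ y ≤ W × (0 < ℓ y → u * ℓ y ≡ W))
    weight y with 0 ℕ.<? ℓ y
    ... | no z = 0 , z≤n , λ p → contradiction p z
    ... | yes p with ∣n! p (≤-trans (#-mono (λ z → Adj? G y z ×-dec Low? z) (Adj? G y) (λ _ → proj₁))
        (≤-trans (≤-reflexive (≡-sym (deg-# G y))) (deg≤k y)))
    ...   | divides u e = u , ≤-reflexive (≡-sym e) , λ _ → ≡-sym e

    u : Fin n → ℕ
    u y = proj₁ (weight y)

    0<k : 0 < k
    0<k = ≤-trans (s≤s z≤n) k-large

    out? : ∀ v → Dec (¬ v ∈ˢ S)
    out? v = ¬? (v ∈ˢ? S)
    low? : ∀ v → Dec (v ∈ˢ S × Low v)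
    low? v = (v ∈ˢ? S) ×-dec Low? v
    high? : ∀ v → Dec (v ∈ˢ S × ¬ Low v)
    high? v = (v ∈ˢ? S) ×-dec ¬? (Low? v)

    adj-out : ∀ {x y} → x ∈ˢ S → Adj G x y → ¬ y ∈ˢ S
    adj-out {x} {y} xS xy yS with trans (≡-sym (indep x y xS yS)) xy
    ... | ()

    -- Each y in the set from `spread` has 1 / ℓ(y) at least s divided by the size of that set, so
    -- these fractions alone add up to s.
    spread-weight : ∀ {x} → Low x → s * W ≤ sum (λ y → ind (Adj? G x y) * u y)
    spread-weight {x} low with spread low
    ... | Q , Q? , 0<m , ok = ℕₚ.*-cancelˡ-≤ (# Q?) {{ℕ.>-nonZero 0<m}} (begin
      # Q? * (s * W) ≡⟨ *-distribʳ-sum (s * W) (λ y → ind (Q? y)) ⟩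
      sum (λ y → ind (Q? y) * (s * W)) ≤⟨ sum-mono (λ y → pt y (Q? y)) ⟩
      sum (λ y → # Q? * (ind (Adj? G x y) * u y)) ≡⟨ *-distribˡ-sum (# Q?) (λ y → ind (Adj? G x y) * u y) ⟨
      # Q? * sum (λ y → ind (Adj? G x y) * u y) ∎)
      where
      ar : ∀ a b c → a * (b * c) ≡ (a * c) * b
      ar = solve-∀
      pt : ∀ y (d : Dec (Q y)) → ind d * (s * W) ≤ # Q? * (ind (Adj? G x y) * u y)
      pt y (no _) = z≤n
      pt y (yes Qy) = begin
        1 * (s * W) ≡⟨ ℕₚ.*-identityˡ (s * W) ⟩
        s * W ≡⟨ cong (s *_) (proj₂ (proj₂ (weight y)) 0<ℓ) ⟨
        s * (u y * ℓ y) ≡⟨ ar s (u y) (ℓ y) ⟩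
        s * ℓ y * u y ≤⟨ ℕₚ.*-monoˡ-≤ (u y) (proj₂ (ok y Qy)) ⟩
        # Q? * u y ≡⟨ cong (# Q? *_) (trans (≡-sym (ℕₚ.*-identityˡ (u y)))
            (cong (_* u y) (≡-sym (ind-yes (Adj? G x y) (proj₁ (ok y Qy)))))) ⟩
        # Q? * (ind (Adj? G x y) * u y) ∎
        where
        0<ℓ : 0 < ℓ y
        0<ℓ = ≤-trans (s≤s z≤n) (#-∖< (λ z → Adj? G y z ×-dec Low? z) x (Adj-sym G (proj₁ (ok y Qy)) , low))

    -- Every y outside `S` shares a total of at most 1 equally among its low neighbours. A low
    -- vertex of `S` has all its neighbours outside `S` and receives at least s by `spread-weight`.
    low-bound : s * # low? ≤ # out?
    low-bound = ℕₚ.*-cancelʳ-≤ (s * # low?) (# out?) W {{k !≢0}} (begin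
      s * # low? * W ≡⟨ ar s (# low?) W ⟩
      # low? * (s * W) ≡⟨ *-distribʳ-sum (s * W) (λ x → ind (low? x)) ⟩
      sum (λ x → ind (low? x) * (s * W)) ≤⟨ sum-mono (λ x → pt x (low? x)) ⟩
      sum (λ x → sum (λ y → ind (low? x) * (ind (Adj? G x y) * u y)))
          ≡⟨ ∑-comm (λ x y → ind (low? x) * (ind (Adj? G x y) * u y)) ⟩
      sum (λ y → sum (λ x → ind (low? x) * (ind (Adj? G x y) * u y))) ≤⟨ sum-mono col ⟩
      sum (λ y → ind (out? y) * W) ≡⟨ *-distribʳ-sum W (λ y → ind (out? y)) ⟨
      # out? * W ∎)
      where
      ar : ∀ a b c → a * b * c ≡ b * (a * c)
      ar = solve-∀
      pt : ∀ x (d : Dec (x ∈ˢ S × Low x)) → ind d * (s * W) ≤ sum (λ y → ind d * (ind (Adj? G x y) * u y))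
      pt x d@(no _) = z≤n
      pt x d@(yes (_ , l)) = ≤-trans (ℕₚ.*-monoʳ-≤ 1 (spread-weight l))
          (≤-reflexive (*-distribˡ-sum 1 (λ y → ind (Adj? G x y) * u y)))
      col : ∀ y → sum (λ x → ind (low? x) * (ind (Adj? G x y) * u y)) ≤ ind (out? y) * W
      col y = begin
        sum (λ x → ind (low? x) * (ind (Adj? G x y) * u y))
          ≤⟨ sum-mono (λ x → ≤-trans (≤-reflexive (≡-sym (ℕₚ.*-assoc (ind (low? x)) _ (u y))))
               (ℕₚ.*-monoˡ-≤ (u y) (ind-*-mono (low? x) (Adj? G x y) (out? y) (Adj? G y x ×-dec Low? x)
                 (λ { (xS , l) xy → adj-out xS xy , Adj-sym G xy , l })))) ⟩
        sum (λ x → ind (out? y) * ind (Adj? G y x ×-dec Low? x) * u y)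
            ≡⟨ *-distribʳ-sum (u y) (λ x → ind (out? y) * ind (Adj? G y x ×-dec Low? x)) ⟨
        sum (λ x → ind (out? y) * ind (Adj? G y x ×-dec Low? x)) * u y
            ≡⟨ cong (_* u y) (*-distribˡ-sum (ind (out? y)) (λ x → ind (Adj? G y x ×-dec Low? x))) ⟨
        ind (out? y) * ℓ y * u y ≡⟨ trans (ℕₚ.*-assoc (ind (out? y)) (ℓ y) (u y))
            (cong (ind (out? y) *_) (ℕₚ.*-comm (ℓ y) (u y))) ⟩
        ind (out? y) * (u y * ℓ y) ≤⟨ ℕₚ.*-monoʳ-≤ (ind (out? y)) (proj₁ (proj₂ (weight y))) ⟩
        ind (out? y) * W ∎

    high-bound : s * # high? ≤ q * # out?
    high-bound = ℕₚ.*-cancelʳ-≤ (s * # high?) (q * # out?) k {{ℕ.>-nonZero 0<k}} (begin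
      s * # high? * k ≡⟨ ar s (# high?) k ⟩
      # high? * (s * k) ≡⟨ *-distribʳ-sum (s * k) (λ x → ind (high? x)) ⟩
      sum (λ x → ind (high? x) * (s * k)) ≤⟨ sum-mono (λ x → pt x (high? x)) ⟩
      sum (λ x → q * (ind (high? x) * deg G x)) ≡⟨ *-distribˡ-sum q (λ x → ind (high? x) * deg G x) ⟨
      q * sum (λ x → ind (high? x) * deg G x) ≤⟨ ℕₚ.*-monoʳ-≤ q (begin
        sum (λ x → ind (high? x) * deg G x) ≡⟨ sum-cong-≗
            (λ x → trans (cong (ind (high? x) *_) (deg-# G x))
            (*-distribˡ-sum (ind (high? x)) (λ y → ind (Adj? G x y)))) ⟩
        sum (λ x → sum (λ y → ind (high? x) * ind (Adj? G x y)))
            ≡⟨ ∑-comm (λ x y → ind (high? x) * ind (Adj? G x y)) ⟩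
        sum (λ y → sum (λ x → ind (high? x) * ind (Adj? G x y)))
          ≤⟨ sum-mono (λ y → sum-mono (λ x → ind-*-mono (high? x) (Adj? G x y) (out? y) (Adj? G y x)
              (λ { (xS , _) xy → adj-out xS xy , Adj-sym G xy }))) ⟩
        sum (λ y → sum (λ x → ind (out? y) * ind (Adj? G y x)))
          ≡⟨ sum-cong-≗ (λ y → trans (cong (ind (out? y) *_) (deg-# G y))
              (*-distribˡ-sum (ind (out? y)) (λ x → ind (Adj? G y x)))) ⟨
        sum (λ y → ind (out? y) * deg G y) ≤⟨ sum-mono (λ y → ℕₚ.*-monoʳ-≤ (ind (out? y)) (deg≤k y)) ⟩
        sum (λ y → ind (out? y) * k) ≡⟨ *-distribʳ-sum k (λ y → ind (out? y)) ⟨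
        # out? * k ∎) ⟩
      q * (# out? * k) ≡⟨ ℕₚ.*-assoc q (# out?) k ⟨
      q * # out? * k ∎)
      where
      ar : ∀ a b c → a * b * c ≡ b * (a * c)
      ar = solve-∀
      pt : ∀ x (d : Dec (x ∈ˢ S × ¬ Low x)) → ind d * (s * k) ≤ q * (ind d * deg G x)
      pt x (no _) = z≤n
      pt x (yes (_ , h)) = begin
        1 * (s * k) ≡⟨ ℕₚ.*-identityˡ (s * k) ⟩
        -- Since q = s + 1, failing `Low` means q deg x + k > s k + k.
        s * k ≤⟨ ℕₚ.<⇒≤ (ℕₚ.+-cancelʳ-< k (s * k) (q * deg G x)
            (≤-trans (≤-reflexive (cong suc (ℕₚ.+-comm (s * k) k))) (ℕₚ.≰⇒> h))) ⟩
        q * deg G x ≡⟨ cong (q *_) (ℕₚ.*-identityˡ (deg G x)) ⟨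
        q * (1 * deg G x) ∎

    -- The two bounds give s |S| ≤ (s + 2)(n - |S|); adding (s + 2) |S| to both sides avoids the
    -- subtraction.
    independent-bound : (2 * s + 2) * ∣ S ∣ ≤ (s + 2) * n
    independent-bound = begin
      (2 * s + 2) * ∣ S ∣ ≡⟨ cong ((2 * s + 2) *_) (∣S∣-# S) ⟩
      (2 * s + 2) * a ≡⟨ ar₁ s a ⟩
      s * a + (s + 2) * a ≤⟨ ℕₚ.+-monoˡ-≤ ((s + 2) * a) (begin
        s * a ≤⟨ ℕₚ.*-monoʳ-≤ s (#-cover (_∈ˢ? S) low? high? split) ⟩
        s * (# low? + # high?) ≡⟨ ℕₚ.*-distribˡ-+ s (# low?) (# high?) ⟩
        s * # low? + s * # high? ≤⟨ +-mono-≤ low-bound high-bound ⟩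
        # out? + suc s * # out? ≡⟨ ar₂ s (# out?) ⟩
        (s + 2) * # out? ∎) ⟩
      (s + 2) * # out? + (s + 2) * a ≡⟨ ar₃ s (# out?) a ⟩
      (s + 2) * (a + # out?) ≡⟨ cong ((s + 2) *_) (#-compl (_∈ˢ? S)) ⟩
      (s + 2) * n ∎
      where
      a : ℕ
      a = # (_∈ˢ? S)
      ar₁ : ∀ s a → (2 * s + 2) * a ≡ s * a + (s + 2) * a
      ar₁ = solve-∀
      ar₂ : ∀ s t → t + suc s * t ≡ (s + 2) * t
      ar₂ = solve-∀
      ar₃ : ∀ s t a → (s + 2) * t + (s + 2) * a ≡ (s + 2) * (a + t)
      ar₃ = solve-∀
      split : ∀ v → v ∈ˢ S → (v ∈ˢ S × Low v) ⊎ (v ∈ˢ S × ¬ Low v)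
      split v vS with Low? v
      ... | yes l = inj₁ (vS , l)
      ... | no h = inj₂ (vS , h)

  -- Turns a ≤ (½ + 1 / 2(s + 1)) n with s the denominator of ε into a < (½ + ε) n.
  bound⇒< : ∀ (ε : ℚ) → 0ℚ ℚ.< ε → ∀ {a n} → 0 < n → (2 * ℚ.↧ₙ ε + 2) * a ≤ (ℚ.↧ₙ ε + 2) * n →
    (ℤ.+ a ℚ./ 1) ℚ.< (½ ℚ.+ ε) ℚ.* (ℤ.+ n ℚ./ 1)
  bound⇒< ε 0<ε {a} {n} 0<n le = ℚₚ.toℚᵘ-cancel-<
      (ℚᵘₚ.<-respˡ-≃ (ℚᵘₚ.≃-sym (ℚₚ.toℚᵘ-fromℚᵘ (mkℚᵘ (ℤ.+ a) 0)))
          (ℚᵘₚ.<-respʳ-≃ (ℚᵘₚ.≃-sym rhs) (main ε (ℚ.positive 0<ε) le)))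
    where
    rhs : toℚᵘ ((½ ℚ.+ ε) ℚ.* (ℤ.+ n ℚ./ 1)) ℚᵘ.≃ (toℚᵘ ½ ℚᵘ.+ toℚᵘ ε) ℚᵘ.* mkℚᵘ (ℤ.+ n) 0
    rhs = ℚᵘₚ.≃-trans (ℚₚ.toℚᵘ-homo-* (½ ℚ.+ ε) (ℤ.+ n ℚ./ 1))
        (ℚᵘₚ.*-cong (ℚₚ.toℚᵘ-homo-+ ½ ε) (ℚₚ.toℚᵘ-fromℚᵘ (mkℚᵘ (ℤ.+ n) 0)))
    main : ∀ ε → ℚ.Positive ε → (2 * ℚ.↧ₙ ε + 2) * a ≤ (ℚ.↧ₙ ε + 2) * n →
        mkℚᵘ (ℤ.+ a) 0 ℚᵘ.< (toℚᵘ ½ ℚᵘ.+ toℚᵘ ε) ℚᵘ.* mkℚᵘ (ℤ.+ n) 0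
    main (mkℚ (ℤ.+ suc e) d-1 _) _ le = ℚᵘ.*<* (subst₂ ℤ._<_ (ℤₚ.pos-* a (2 * d * 1))
        (trans (ℤₚ.pos-* (X * n) 1) (cong (ℤ._* (ℤ.+ 1)) (ℤₚ.pos-* X n))) (ℤ.+<+ (begin-strict
      a * (2 * d * 1) ≡⟨ ar₁ d a ⟩
      2 * d * a <⟨ lt a le ⟩
      -- The numerator `suc e` of a positive ε is at least 1, that is, ε ≥ 1/d.
      (d + 2) * n ≤⟨ ℕₚ.*-monoˡ-≤ n (ℕₚ.+-monoʳ-≤ d (ℕₚ.*-monoʳ-≤ 2 (s≤s (z≤n {e})))) ⟩
      (d + 2 * suc e) * n ≡⟨ ar₂ d (suc e) n ⟩
      X * n * 1 ∎)))
      where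
      open ≤-Reasoning
      d X : ℕ
      d = suc d-1
      X = 1 * d + suc e * 2
      ar₁ : ∀ d a → a * (2 * d * 1) ≡ 2 * d * a
      ar₁ = solve-∀
      ar₂ : ∀ d e n → (d + 2 * e) * n ≡ (1 * d + e * 2) * n * 1
      ar₂ = solve-∀
      lt : ∀ a → (2 * d + 2) * a ≤ (d + 2) * n → 2 * d * a < (d + 2) * n
      -- For positive `a` strictness comes from 2d < 2d + 2; for `a = 0` it comes from n > 0.
      lt zero _ = ≤-trans (s≤s (≤-reflexive (ℕₚ.*-zeroʳ (2 * d)))) (ℕₚ.*-mono-≤ {1} {d + 2} (s≤s z≤n) 0<n)
      lt (suc a) le = ≤-trans (ℕₚ.*-monoˡ-< (suc a) (ℕₚ.m<m+n (2 * d) {2} (s≤s z≤n))) le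

open import Data.Nat using (ℕ; zero; suc; s≤s; z≤n; _≤_)
open import Data.Integer using (+_)
open import Data.Rational using (ℚ; 0ℚ; 1ℚ; ½; _/_; ↧ₙ_; _+_; _*_; _<_)
open import Data.Product using (_×_; _,_; proj₁; ∃-syntax)
open import Data.Nat.Properties using (≤-refl)
open import Relation.Binary.PropositionalEquality using (refl)

theorem1p4 : (ε : ℚ) → 0ℚ < ε → ε < 1ℚ →
    ∃[ d₀ ] ∃[ D₀ ] (1 ≤ d₀ × 1 ≤ D₀ ×
    (∀ (n : ℕ) (G : Graph n) → Critical G →
    (∀ v → d₀ ≤ deg G v) → D₀ ≤ maxDeg G →
    ∀ (a : ℕ) → IsIndependenceNumber G a →
    (+ a / 1) < (½ + ε) * (+ n / 1)))
theorem1p4 ε 0<ε _ = Constants.d₀ s , Constants.D₀ s , s≤s z≤n , s≤s z≤n , bound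
  where
  open CriticalGraphs
  s : ℕ
  -- A positive rational is at least 1 over its denominator, so 1 / (2(s + 1)) is below ε.
  s = ↧ₙ ε
  bound : ∀ (n : ℕ) (G : Graph n) → Critical G → (∀ v → Constants.d₀ s ≤ deg G v) → Constants.D₀ s ≤ maxDeg G →
    ∀ (a : ℕ) → IsIndependenceNumber G a → (+ a / 1) < (½ + ε) * (+ n / 1)
  -- The graph without vertices has maximum degree 0, less than `D₀`.
  bound zero G _ _ ()
  bound n@(suc _) G (_ , (_ , uncolourable) , critical) large-deg large-Δ a ((S , indep , refl) , _) =
    bound⇒< ε 0<ε (s≤s z≤n)
      (Counting.independent-bound G (maxDeg G) s (s≤s z≤n) (deg≤maxDeg G) (uncolourable (maxDeg G) ≤-refl)
        (λ x y xy → proj₁ (critical x y xy)) large-deg large-Δ S indep)
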